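{- Let $n$ be a nonnegative integer. Then there is an extremal square-free circular word of length $n$ over the alphabet $\Gamma=\{\mathtt{a},\mathtt{b},\mathtt{c}\}$ if and only if \[ n\in\{4,6,8,13,15,16,18,20,21,22,23,24,28,30,32,33,34,35,36\}\cup\{m\colon m\geq 38\}. \]
   Context: A word is square-free if it contains no factor of the form $xx$ with $x$ nonempty. Words $u,v$ are conjugates if $u=xy$ and $v=yx$ for some words $x,y$. For a word $w$ over $\Sigma$, the circular word $\langle w\rangle$ is the set of all conjugates of $w$; its length is $|w|$. The circular word $\langle w\rangle$ is square-free if every conjugate of $w$ is square-free. An extension of $\langle w\rangle$ is a circular word $\langle w'aw''\rangle$ where $a\in\Sigma$ and $w=w'w''$. The circular word $\langle w\rangle$ is extremal square-free if $\langle w\rangle$ is square-free and every extension of $\langle w\rangle$ is not square-free (i.e., some conjugate of it contains a square). -}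

module Defs where

open import Data.Nat using (ℕ; _≤_)
open import Data.Fin using (Fin)
open import Data.List using (List; []; _∷_; _++_; length)
open import Data.List.Membership.Propositional using (_∈_)
open import Data.Product using (Σ; ∃; _×_; _,_)
open import Data.Sum using (_⊎_)
open import Relation.Nullary using (¬_)
open import Relation.Binary.PropositionalEquality using (_≡_; _≢_)

-- The alphabet Γ = {a, b, c}, encoded as Fin 3 (a = 0, b = 1, c = 2).
Γ : Set
Γ = Fin 3

Word : Set
Word = List Γ

HasSquare : Word → Set
HasSquare w = ∃ λ (x : Word) → ∃ λ (y : Word) → ∃ λ (z : Word) →
  (x ≢ []) × (w ≡ y ++ (x ++ (x ++ z)))

SquareFree : Word → Set
SquareFree w = ¬ HasSquare w

Conjugate : Word → Word → Set
Conjugate u v = ∃ λ (x : Word) → ∃ λ (y : Word) → (u ≡ x ++ y) × (v ≡ y ++ x)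

CircSquareFree : Word → Set
CircSquareFree w = ∀ (v : Word) → Conjugate w v → SquareFree v

IsExtension : Word → Word → Set
IsExtension w v = ∃ λ (w₁ : Word) → ∃ λ (w₂ : Word) → ∃ λ (a : Γ) →
  (w ≡ w₁ ++ w₂) × (v ≡ w₁ ++ (a ∷ w₂))

ExtremalSquareFree : Word → Set
ExtremalSquareFree w = CircSquareFree w × (∀ (v : Word) → IsExtension w v → ¬ CircSquareFree v)

smallLengths : List ℕ
smallLengths = 4 ∷ 6 ∷ 8 ∷ 13 ∷ 15 ∷ 16 ∷ 18 ∷ 20 ∷ 21 ∷ 22 ∷ 23 ∷ 24 ∷
  28 ∷ 30 ∷ 32 ∷ 33 ∷ 34 ∷ 35 ∷ 36 ∷ []

GoodLength : ℕ → Set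
GoodLength n = (n ∈ smallLengths) ⊎ (38 ≤ n)

{-# OPTIONS --safe #-}

-- Circular square-freeness of w only concerns the factors of w w of length at most |w|,
-- so extremality is decidable. The lengths up to 37 are settled by a backtracking search,
-- and the listed lengths and those from 38 to 134 by explicit words. For larger lengths
-- each letter of a shorter circular square-free word is replaced by a block. Every letter
-- has blocks of eight different lengths, all starting with a common marker that occurs
-- nowhere else in the image, so that a square in the image forces a square of letters;
-- and in every block each insertion creates a square nearby, so that the image is extremal.

module Submission where

open import Defs
import Algebra.Properties.CommutativeSemigroup as CommutativeSemigroup
open import Data.Bool using (Bool; true; false; not; _∨_; _∧_; T)
open import Data.Bool.Properties using (T-∨; T-∧; T-≡)
import Data.Char as Char
open import Data.Empty using (⊥)
open import Data.Fin using (Fin; zero; suc; toℕ; fromℕ<; opposite)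
import Data.Fin.Properties as Fin
open import Data.List using (List; []; _∷_; _++_; length; map; drop; take; concatMap; applyUpTo; _∷ʳ_; initLast; _∷ʳ′_)
open import Data.List.Membership.Propositional using (_∈_; _∉_)
open import Data.List.Membership.Propositional.Properties using (∈-++⁺ˡ; ∈-++⁺ʳ; ∈-map⁻; ∈-applyUpTo⁺)
open import Data.List.Properties
open import Data.List.Relation.Unary.All as All using (All)
open import Data.Nat
open import Data.Nat.DivMod
open import Data.Nat.Induction using (<-rec)
open import Data.Nat.Properties
open import Data.List.Membership.DecPropositional _≟_ using (_∈?_)
open import Data.Nat.Solver using (module +-*-Solver)
open import Data.Product using (∃; ∃₂; _×_; _,_; proj₁; proj₂)
open import Data.String using (String; toList)
open import Data.Sum using (_⊎_; inj₁; inj₂; [_,_]′)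
open import Data.Unit using (tt)
open import Function using (_∘_)
open import Function.Bundles using (Equivalence; _⇔_; mk⇔)
open import Relation.Binary.PropositionalEquality
open import Relation.Nullary using (¬_; Dec; does; yes; no; contradiction; ¬?)
open import Relation.Nullary.Decidable using (map′; _×-dec_; _→-dec_; T?; decidable-stable; from-yes; from-no)
open import Algebra.Solver.Monoid (++-monoid Γ) using (_⊕_; _⊜_) renaming (solve to ++-solve; id to nil)
open +-*-Solver using (_:+_; _:*_; _:=_; con) renaming (solve to +-*-solve)

-- Two blocks of the same letter need not be equal, so a square `x x` in an image cannot be pulled
-- back block by block: the block cut by the seam between the two copies of `x` may be matched only
-- in part, by another block. What is recovered is its letter. A common prefix of 24 letters or a
-- common suffix of 20 determines the letter, and since the shortest block has 43 letters, every cut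
-- of a block leaves at least 24 letters on the left or at least 20 on the right.
--
-- The block lengths are 43 plus one of eight amounts up to 26, chosen so that three blocks realise
-- every total from 135 = 3 · 43 + 6 to 195 = 3 · 69 - 12. A word of m ≥ 3 letters then has images
-- of every length from 43 m + 6 to 69 m - 12, and explicit words are needed only up to 134. An
-- extremal word is circular square-free, so it can serve as input again, which closes the
-- induction.

private variable
  A : Set

-- Squares in circular words

++-split : ∀ (s : List A) {t} u {v} → s ++ t ≡ u ++ v →
  (∃ λ q → u ≡ s ++ q × t ≡ q ++ v) ⊎
  (∃₂ λ c q → s ≡ u ++ c ∷ q × v ≡ c ∷ q ++ t)
++-split []      u       eq = inj₁ (u , refl , eq)
++-split (c ∷ s) []      eq = inj₂ (c , s , refl , sym eq)
++-split (c ∷ s) (d ∷ u) eq with ∷-injective eq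
... | refl , eq′ with ++-split s u eq′
...   | inj₁ (q , refl , t≡)     = inj₁ (q , refl , t≡)
...   | inj₂ (e , q , refl , v≡) = inj₂ (e , q , refl , v≡)

++-split-≤ : ∀ (s : List A) {t} u {v} → length s ≤ length u → s ++ t ≡ u ++ v →
  ∃ λ q → u ≡ s ++ q × t ≡ q ++ v
++-split-≤ s u s≤u eq with ++-split s u eq
... | inj₁ r = r
... | inj₂ (c , q , refl , _) =
  contradiction (≤-trans (≤-reflexive (sym (length-++ u))) s≤u) (m+1+n≰m (length u))

infix 4 _Repeats_

record _Repeats_ (m : ℕ) (u : Word) : Set where
  constructor repeats
  field
    before root after : Word
    root≢[]  : root ≢ []
    within   : length root + length root ≤ m
    factor   : u ≡ before ++ root ++ root ++ after

square⇒repeats : ∀ {u} → HasSquare u → length u Repeats u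
square⇒repeats (x , y , z , x≢[] , refl) = repeats y x z x≢[] fits refl
  where
  fits : length x + length x ≤ length (y ++ x ++ x ++ z)
  fits = begin
    length x + length x              ≤⟨ +-monoʳ-≤ (length x) (m≤m+n (length x) (length z)) ⟩
    length x + (length x + length z) ≡⟨ cong (length x +_) (length-++ x) ⟨
    length x + length (x ++ z)       ≡⟨ length-++ x ⟨
    length (x ++ x ++ z)             ≤⟨ m≤n+m _ (length y) ⟩
    length y + length (x ++ x ++ z)  ≡⟨ length-++ y ⟨
    length (y ++ x ++ x ++ z)        ∎
    where open ≤-Reasoning

hasSquare-++ : ∀ u {w} v → HasSquare w → HasSquare (u ++ w ++ v)
hasSquare-++ u v (x , y , z , x≢[] , refl) = x , u ++ y , z ++ v , x≢[] ,
  ++-solve 5 (λ u y x z v → u ⊕ (y ⊕ x ⊕ x ⊕ z) ⊕ v ⊜ (u ⊕ y) ⊕ x ⊕ x ⊕ z ⊕ v) refl u y x z v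

hasSquare-++ʳ : ∀ {w} v → HasSquare w → HasSquare (w ++ v)
hasSquare-++ʳ = hasSquare-++ []

hasSquare-++ˡ : ∀ u {w} → HasSquare w → HasSquare (u ++ w)
hasSquare-++ˡ u {w} sq = subst (HasSquare ∘ (u ++_)) (++-identityʳ w) (hasSquare-++ u [] sq)

-- A square that starts in the first copy, at `w = y r`, is a prefix of `r w = r y r`, and the bound
-- `2|x| ≤ |w|` keeps it inside the conjugate `r y`. A square that starts in the second copy lies in
-- `w` itself.
circular⇒¬repeats : ∀ {w} → CircSquareFree w → ¬ (length w Repeats w ++ w)
circular⇒¬repeats {w} circ (repeats y x z x≢[] 2x≤w eq) with ++-split w y eq
... | inj₁ (q , _ , w≡) = circ w ([] , w , refl , sym (++-identityʳ w)) (x , q , z , x≢[] , w≡)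
... | inj₂ (c , q , w≡ , xxz≡) with ++-split-≤ (x ++ x) ((c ∷ q) ++ y) fits eq′
  where
  r = c ∷ q
  eq′ : (x ++ x) ++ z ≡ (r ++ y) ++ r
  eq′ = begin
    (x ++ x) ++ z ≡⟨ ++-assoc x x z ⟩
    x ++ x ++ z   ≡⟨ xxz≡ ⟩
    r ++ w        ≡⟨ cong (r ++_) w≡ ⟩
    r ++ y ++ r   ≡⟨ ++-assoc r y r ⟨
    (r ++ y) ++ r ∎
    where open ≡-Reasoning
  fits : length (x ++ x) ≤ length (r ++ y)
  fits = begin
    length (x ++ x)      ≡⟨ length-++ x ⟩
    length x + length x  ≤⟨ 2x≤w ⟩
    length w             ≡⟨ cong length w≡ ⟩
    length (y ++ r)      ≡⟨ length-++-comm y r ⟩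
    length (r ++ y)      ∎
    where open ≤-Reasoning
... | t , ry≡ , _ = circ ((c ∷ q) ++ y) (y , c ∷ q , w≡ , refl)
                      (x , [] , t , x≢[] , trans ry≡ (++-assoc x x t))

¬repeats⇒circular : ∀ {w} → ¬ (length w Repeats w ++ w) → CircSquareFree w
¬repeats⇒circular ¬rep _ (X , Y , refl , refl) sq with square⇒repeats sq
... | repeats y x z x≢[] fits eq = ¬rep record
  { before  = X ++ y
  ; root    = x
  ; after   = z ++ Y
  ; root≢[] = x≢[]
  ; within  = ≤-trans fits (≤-reflexive (length-++-comm Y X))
  ; factor  = begin
      (X ++ Y) ++ X ++ Y                 ≡⟨ ++-solve 2 (λ X Y → (X ⊕ Y) ⊕ X ⊕ Y ⊜ X ⊕ (Y ⊕ X) ⊕ Y) refl X Y ⟩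
      X ++ (Y ++ X) ++ Y                 ≡⟨ cong (λ w → X ++ w ++ Y) eq ⟩
      X ++ (y ++ x ++ x ++ z) ++ Y       ≡⟨ ++-solve 5 (λ X Y y x z → X ⊕ (y ⊕ x ⊕ x ⊕ z) ⊕ Y ⊜ (X ⊕ y) ⊕ x ⊕ x ⊕ z ⊕ Y) refl X Y y x z ⟩
      (X ++ y) ++ x ++ x ++ z ++ Y       ∎
  }
  where
  open ≡-Reasoning

circular⇒squareFree : ∀ {w} → CircSquareFree w → SquareFree w
circular⇒squareFree {w} circ = circ w ([] , w , refl , sym (++-identityʳ w))

circular-conjugate : ∀ u s → CircSquareFree (u ++ s) → CircSquareFree (s ++ u)
circular-conjugate u s circ _ (X , Y , eq , refl) with ++-split s X eq
... | inj₁ (q , refl , refl)     = circ _ (q , Y ++ s , ++-assoc q Y s , sym (++-assoc Y s q))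
... | inj₂ (c , q , refl , refl) = circ _ (u ++ X , c ∷ q , sym (++-assoc u X (c ∷ q)) , ++-assoc (c ∷ q) u X)

-- Decision procedures

sameᵇ : ∀ {n} → Fin n → Fin n → Bool
sameᵇ zero    zero    = true
sameᵇ (suc i) (suc j) = sameᵇ i j
sameᵇ _       _       = false

sameᵇ-sound : ∀ {n} (i j : Fin n) → T (sameᵇ i j) → i ≡ j
sameᵇ-sound zero    zero    _  = refl
sameᵇ-sound (suc i) (suc j) eq = cong suc (sameᵇ-sound i j eq)

sameᵇ-refl : ∀ {n} (i : Fin n) → sameᵇ i i ≡ true
sameᵇ-refl zero    = refl
sameᵇ-refl (suc i) = sameᵇ-refl i

agreeᵇ : ℕ → Word → Word → Bool
agreeᵇ zero    _       _       = true
agreeᵇ (suc p) (c ∷ s) (d ∷ t) = sameᵇ c d ∧ agreeᵇ p s t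
agreeᵇ (suc p) _       _       = false

agree-sound : ∀ p s t → T (agreeᵇ p s t) →
  ∃ λ x → ∃₂ λ s′ t′ → length x ≡ p × s ≡ x ++ s′ × t ≡ x ++ t′
agree-sound zero    s t _ = [] , s , t , refl , refl , refl
agree-sound (suc p) (c ∷ s) (d ∷ t) eq with T-∧ .Equivalence.to eq
... | c≡d , eq′ with sameᵇ-sound c d c≡d | agree-sound p s t eq′
...   | refl | x , s′ , t′ , refl , refl , refl = c ∷ x , s′ , t′ , refl , refl , refl

agree-complete : ∀ x s t → T (agreeᵇ (length x) (x ++ s) (x ++ t))
agree-complete []      s t = tt
agree-complete (c ∷ x) s t rewrite sameᵇ-refl c = agree-complete x s t

-- Tests the first n starting positions; t is kept equal to drop p s, so that
-- no step has to recompute it.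
squareWithinᵇ : (n p : ℕ) → Word → Word → Bool
squareWithinᵇ zero    p s       t = false
squareWithinᵇ (suc n) p []      t = false
squareWithinᵇ (suc n) p (c ∷ s) t = agreeᵇ p (c ∷ s) t ∨ squareWithinᵇ n p s (drop 1 t)

drop-1-drop : ∀ p (u : List A) → drop 1 (drop p u) ≡ drop (suc p) u
drop-1-drop p u = trans (drop-drop p 1 u) (cong (λ k → drop k u) (+-comm p 1))

drop-length-++ : ∀ (x : List A) y → drop (length x) (x ++ y) ≡ y
drop-length-++ []      y = refl
drop-length-++ (_ ∷ x) y = drop-length-++ x y

squarePrefix-sound : ∀ p s → T (agreeᵇ p s (drop p s)) → ∃₂ λ x z → length x ≡ p × s ≡ x ++ x ++ z
squarePrefix-sound p s sq with agree-sound p s (drop p s) sq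
... | x , s′ , t′ , refl , refl , t≡ =
  x , t′ , refl , cong (x ++_) (trans (sym (drop-length-++ x s′)) t≡)

squarePrefix-complete : ∀ x z → T (agreeᵇ (length x) (x ++ x ++ z) (drop (length x) (x ++ x ++ z)))
squarePrefix-complete x z rewrite drop-length-++ x (x ++ z) = agree-complete x (x ++ z) z

squareWithin-sound : ∀ n p s → T (squareWithinᵇ n (suc p) s (drop (suc p) s)) →
  ∃ λ x → ∃₂ λ y z → length x ≡ suc p × s ≡ y ++ x ++ x ++ z
squareWithin-sound (suc n) p (c ∷ s) sq
  with T-∨ {agreeᵇ (suc p) (c ∷ s) (drop p s)} .Equivalence.to sq
... | inj₁ here with squarePrefix-sound (suc p) (c ∷ s) here
...   | x , z , ∣x∣ , eq = x , [] , z , ∣x∣ , eq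
squareWithin-sound (suc n) p (c ∷ s) sq
    | inj₂ there with squareWithin-sound n p s (subst (T ∘ squareWithinᵇ n (suc p) s) (drop-1-drop p s) there)
...   | x , y , z , ∣x∣ , refl = x , c ∷ y , z , ∣x∣ , refl

squareWithin-complete : ∀ {n p} x y z → length x ≡ suc p → length y < n → let s = y ++ x ++ x ++ z in
  T (squareWithinᵇ n (suc p) s (drop (suc p) s))
squareWithin-complete {suc n} (c ∷ x) [] z refl _ =
  T-∨ .Equivalence.from (inj₁ (squarePrefix-complete (c ∷ x) z))
squareWithin-complete {suc n} {p} x (c ∷ y) z ∣x∣ (s≤s y<n) =
  T-∨ {agreeᵇ (suc p) (c ∷ s) (drop p s)} .Equivalence.from (inj₂ (subst (T ∘ squareWithinᵇ n (suc p) s)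
    (sym (drop-1-drop p s)) (squareWithin-complete x y z ∣x∣ y<n)))
  where s = y ++ x ++ x ++ z

-- As in `squareWithinᵇ`, `t` travels along as `drop p u`. A test that depends on the period alone
-- is run with empty words.
anyPeriodᵇ : (ℕ → Word → Word → Bool) → (k p : ℕ) → Word → Word → Bool
anyPeriodᵇ f zero    p u t = false
anyPeriodᵇ f (suc k) p u t = f p u t ∨ anyPeriodᵇ f k (suc p) u (drop 1 t)

anyPeriod-sound : ∀ f k p u → T (anyPeriodᵇ f k p u (drop p u)) →
  ∃ λ q → p ≤ q × q < p + k × T (f q u (drop q u))
anyPeriod-sound f (suc k) p u sq with T-∨ {f p u (drop p u)} .Equivalence.to sq
... | inj₁ here  = p , ≤-refl , m<m+n p z<s , here
... | inj₂ there with anyPeriod-sound f k (suc p) u (subst (T ∘ anyPeriodᵇ f k (suc p) u) (drop-1-drop p u) there)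
...   | q , p<q , q< , sq′ = q , <⇒≤ p<q , ≤-trans q< (≤-reflexive (sym (+-suc p k))) , sq′

anyPeriod-complete : ∀ f k p u {q} → p ≤ q → q < p + k → T (f q u (drop q u)) →
  T (anyPeriodᵇ f k p u (drop p u))
anyPeriod-complete f zero p u {q} p≤q q< sq =
  contradiction (≤-trans q< (≤-trans (≤-reflexive (+-identityʳ p)) p≤q)) (n≮n q)
anyPeriod-complete f (suc k) p u {q} p≤q q< sq with m≤n⇒m<n∨m≡n p≤q
... | inj₂ refl = T-∨ .Equivalence.from (inj₁ sq)
... | inj₁ p<q  = T-∨ {f p u (drop p u)} .Equivalence.from (inj₂
  (subst (T ∘ anyPeriodᵇ f k (suc p) u) (sym (drop-1-drop p u))
    (anyPeriod-complete f k (suc p) u p<q (≤-trans q< (≤-reflexive (+-suc p k))) sq)))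

-- The search below extends words at the front, so a new square can only be a prefix.
hasSquarePrefixᵇ : Word → Bool
hasSquarePrefixᵇ u = anyPeriodᵇ agreeᵇ ⌊ length u /2⌋ 1 u (drop 1 u)

hasSquarePrefix-sound : ∀ u → T (hasSquarePrefixᵇ u) → HasSquare u
hasSquarePrefix-sound u sq with anyPeriod-sound agreeᵇ ⌊ length u /2⌋ 1 u sq
... | suc p , _ , _ , here with squarePrefix-sound (suc p) u here
...   | x@(_ ∷ _) , z , _ , eq = x , [] , z , (λ ()) , eq

≤-⌊n/2⌋ : ∀ {m n} → m + m ≤ n → m ≤ ⌊ n /2⌋
≤-⌊n/2⌋ {m} fits = ≤-trans (≤-reflexive (n≡⌊n+n/2⌋ m)) (⌊n/2⌋-mono fits)

⌊n/2⌋-≤ : ∀ {m n} → m ≤ ⌊ n /2⌋ → m + m ≤ n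
⌊n/2⌋-≤ {m} {n} m≤ = ≤-trans
  (+-mono-≤ m≤ (≤-trans m≤ (⌊n/2⌋≤⌈n/2⌉ n))) (≤-reflexive (⌊n/2⌋+⌈n/2⌉≡n n))

hasSquare? : ∀ w → Dec (HasSquare w)
hasSquare? w = map′ sound (complete ∘ square⇒repeats) (T? (test 1 w (drop 1 w)))
  where
  test = anyPeriodᵇ (squareWithinᵇ (length w)) ⌊ length w /2⌋
  sound : T (test 1 w (drop 1 w)) → HasSquare w
  sound sq with anyPeriod-sound (squareWithinᵇ (length w)) ⌊ length w /2⌋ 1 w sq
  ... | suc p , _ , _ , sq′ with squareWithin-sound (length w) p w sq′
  ...   | x@(_ ∷ _) , y , z , refl , eq = x , y , z , (λ ()) , eq
  complete : length w Repeats w → T (test 1 w (drop 1 w))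
  complete (repeats _ [] _ []≢[] _ _) = contradiction refl []≢[]
  complete (repeats y x@(_ ∷ _) z _ fits refl) =
    anyPeriod-complete _ ⌊ length w /2⌋ 1 w (s≤s z≤n) (s≤s (≤-⌊n/2⌋ fits))
      (squareWithin-complete x y z refl (≤-trans (m<m+n (length y) z<s) (≤-reflexive (sym (length-++ y)))))

squareFree? : ∀ w → Dec (SquareFree w)
squareFree? w = ¬? (hasSquare? w)

-- Here `k` is the length of the left part; the `2p + 1` starting positions run from `k - 2p` to
-- `k`. If `k < 2p`, truncated subtraction starts them at 0 and they still reach `k`.
squareNearᵇ : (k p : ℕ) → Word → Bool
squareNearᵇ k p u = test (drop (k ∸ (p + p)) u)
  where
  test : Word → Bool
  test s = squareWithinᵇ (suc (p + p)) p s (drop p s)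

-- Only tries the starting positions for which a square of period p can meet
-- the last letter of α or the first letter of β.
straddlingSquareᵇ : (m : ℕ) → Word → Word → Bool
straddlingSquareᵇ m α β = search (length α) (α ++ β)
  where
  search : ℕ → Word → Bool
  search k u = anyPeriodᵇ (λ p _ _ → squareNearᵇ k p u) ⌊ m /2⌋ 1 [] []

straddlingSquare-sound : ∀ m α β → T (straddlingSquareᵇ m α β) → m Repeats α ++ β
straddlingSquare-sound m α β sq with anyPeriod-sound (λ p _ _ → squareNearᵇ (length α) p (α ++ β)) ⌊ m /2⌋ 1 [] sq
... | suc p , _ , s≤s p< , near
  with squareWithin-sound (suc (suc p + suc p)) p (drop (length α ∸ (suc p + suc p)) (α ++ β)) near
...   | x@(_ ∷ _) , y , z , refl , eq = repeats (take j (α ++ β) ++ y) x z (λ ()) (⌊n/2⌋-≤ p<) (begin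
  α ++ β                                   ≡⟨ take++drop≡id j (α ++ β) ⟨
  take j (α ++ β) ++ drop j (α ++ β)       ≡⟨ cong (take j (α ++ β) ++_) eq ⟩
  take j (α ++ β) ++ y ++ x ++ x ++ z      ≡⟨ ++-assoc (take j (α ++ β)) y _ ⟨
  (take j (α ++ β) ++ y) ++ x ++ x ++ z    ∎)
  where
  open ≡-Reasoning
  j = length α ∸ (length x + length x)

drop-++-≤ : ∀ j (y : List A) {w} → j ≤ length y → drop j (y ++ w) ≡ drop j y ++ w
drop-++-≤ zero    y       _         = refl
drop-++-≤ (suc j) (_ ∷ y) (s≤s j≤y) = drop-++-≤ j y j≤y

-- A square that ends inside `α`, or starts after the first letter of `β`, contradicts one of the
-- two square-freeness hypotheses; all others start in the tested window. The second hypothesis is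
-- about `drop 1 β` because for extensions `β = c ∷ t`, where only `t` is known to be square-free.
straddlingSquare-complete : ∀ m α β → SquareFree α → SquareFree (drop 1 β) →
  m Repeats α ++ β → T (straddlingSquareᵇ m α β)
straddlingSquare-complete m α β sfα sfβ (repeats _ [] _ []≢[] _ _) = contradiction refl []≢[]
straddlingSquare-complete m α β sfα sfβ (repeats y x@(_ ∷ _) z x≢[] fits eq)
  with length y + (length x + length x) ≤? length α | ++-split y α (sym eq)
... | yes inside | _ with ++-split-≤ (y ++ x ++ x) α yxx≤α (trans (++-solve 3 (λ y x z → (y ⊕ x ⊕ x) ⊕ z ⊜ y ⊕ x ⊕ x ⊕ z) refl y x z) (sym eq))
  where
  yxx≤α : length (y ++ x ++ x) ≤ length α
  yxx≤α = ≤-trans (≤-reflexive (trans (length-++ y) (cong (length y +_) (length-++ x)))) inside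
...   | q , refl , _ = contradiction (x , y , q , x≢[] , ++-solve 3 (λ y x q → (y ⊕ x ⊕ x) ⊕ q ⊜ y ⊕ x ⊕ x ⊕ q) refl y x q) sfα
straddlingSquare-complete m α β sfα sfβ (repeats y x@(_ ∷ _) z x≢[] fits eq)
    | no _ | inj₂ (c , q , _ , refl) = contradiction (x , q , z , x≢[] , refl) sfβ
straddlingSquare-complete m α β sfα sfβ (repeats y x@(_ ∷ x′) z x≢[] fits eq)
    | no straddles | inj₁ (q , refl , _) =
  anyPeriod-complete (λ p _ _ → squareNearᵇ (length α) p (α ++ β)) ⌊ m /2⌋ 1 []
    (s≤s z≤n) (s≤s (≤-⌊n/2⌋ fits))
    (subst (λ s → T (squareWithinᵇ (suc 2p) (length x) s (drop (length x) s))) drop≡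
      (squareWithin-complete x (drop j y) z refl (s≤s y-j≤)))
  where
  2p = length x + length x
  j  = length α ∸ 2p
  j≤y : j ≤ length y
  j≤y = m≤n+o⇒m∸n≤o (length α) 2p (≤-trans (<⇒≤ (≰⇒> straddles)) (≤-reflexive (+-comm (length y) 2p)))
  y-j≤ : length (drop j y) ≤ 2p
  y-j≤ = begin
    length (drop j y) ≡⟨ length-drop j y ⟩
    length y ∸ j      ≤⟨ m≤n+o⇒m∸n≤o (length y) j (begin
      length y        ≤⟨ m≤m+n (length y) (length q) ⟩
      length y + length q ≡⟨ length-++ y ⟨
      length α        ≤⟨ m≤n+m∸n (length α) 2p ⟩
      2p + j          ≡⟨ +-comm 2p j ⟩
      j + 2p          ∎) ⟩
    2p                ∎
    where open ≤-Reasoning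
  drop≡ : drop j y ++ x ++ x ++ z ≡ drop j (α ++ β)
  drop≡ = sym (trans (cong (drop j) eq) (drop-++-≤ j y j≤y))

circSquareFree? : ∀ w → Dec (CircSquareFree w)
circSquareFree? w = map′
  (λ (¬str , sf) → ¬repeats⇒circular
    (¬str ∘ straddlingSquare-complete (length w) w w sf (sf ∘ square-drop-1 w)))
  (λ circ → circular⇒¬repeats circ ∘ straddlingSquare-sound (length w) w w , circular⇒squareFree circ)
  (¬? (T? (straddlingSquareᵇ (length w) w w)) ×-dec squareFree? w)
  where
  square-drop-1 : ∀ w → HasSquare (drop 1 w) → HasSquare w
  square-drop-1 []      sq = sq
  square-drop-1 (c ∷ w) sq = hasSquare-++ˡ (c ∷ []) sq

∀-splittings? : {P : Word → Word → Set} → (∀ u s → Dec (P u s)) →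
  ∀ w → Dec (∀ u s → w ≡ u ++ s → P u s)
∀-splittings? {P} P? [] = map′ (λ { p [] [] refl → p }) (λ f → f [] [] refl) (P? [] [])
∀-splittings? {P} P? (c ∷ w) = map′
  (λ { (p , _) [] _ refl → p ; (_ , f) (_ ∷ u) s refl → f u s refl })
  (λ f → f [] (c ∷ w) refl , λ u s eq → f (c ∷ u) s (cong (c ∷_) eq))
  (P? [] (c ∷ w) ×-dec ∀-splittings? (P? ∘ (c ∷_)) w)

-- If w = u s is circularly square-free, a square in an extension contains the inserted
-- letter c, so it is a factor of t c t for the conjugate t = s u of w.
extensionSquareᵇ : Word → Word → Γ → Bool
extensionSquareᵇ u s c = straddle (s ++ u)
  where
  straddle : Word → Bool
  straddle t = straddlingSquareᵇ (suc (length t)) t (c ∷ t)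

extensionSquare-sound : ∀ u s c → T (extensionSquareᵇ u s c) → ¬ CircSquareFree (u ++ c ∷ s)
extensionSquare-sound u s c sq circ with straddlingSquare-sound _ (s ++ u) (c ∷ s ++ u) sq
... | repeats y x z x≢[] fits eq = circular⇒¬repeats (circular-conjugate u (c ∷ s) circ)
  (repeats (c ∷ y) x z x≢[] fits (cong (c ∷_) eq))

-- Up to rotation the extension is `c t`. In `(c t)(c t)` a square that starts after the first
-- letter lies in `t c t`. One that starts at the first letter is short enough to be a prefix of
-- `c t`, so it occurs again in the second copy, inside `t c t`.
extensionSquare-complete : ∀ u s c → CircSquareFree (u ++ s) →
  ¬ T (extensionSquareᵇ u s c) → CircSquareFree (u ++ c ∷ s)
extensionSquare-complete u s c circ ¬sq = circular-conjugate (c ∷ s) u (¬repeats⇒circular ¬repeats)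
  where
  t = s ++ u
  sf : SquareFree t
  sf = circular⇒squareFree (circular-conjugate u s circ)
  ¬repeats : ¬ (suc (length t) Repeats (c ∷ t) ++ c ∷ t)
  ¬repeats (repeats (_ ∷ y) x z x≢[] fits eq) =
    ¬sq (straddlingSquare-complete _ t (c ∷ t) sf sf (repeats y x z x≢[] fits (∷-injectiveʳ eq)))
  ¬repeats (repeats [] x z x≢[] fits eq)
    with ++-split-≤ (x ++ x) (c ∷ t) (≤-trans (≤-reflexive (length-++ x)) fits) (trans (++-assoc x x z) (sym eq))
  ... | q , ct≡ , _ = ¬sq (straddlingSquare-complete _ t (c ∷ t) sf sf
    (repeats t x q x≢[] fits (cong (t ++_) (trans ct≡ (++-assoc x x q)))))

extremal? : ∀ w → Dec (ExtremalSquareFree w)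
extremal? w = map′
  (λ (circ , sq) → circ , λ { _ (u , s , c , eq , refl) → extensionSquare-sound u s c (sq u s eq c) })
  (λ (circ , ext) → circ , λ u s eq c → decidable-stable (T? _) λ ¬sq →
    ext _ (u , s , c , eq , refl) (extensionSquare-complete u s c (subst CircSquareFree eq circ) ¬sq))
  (circSquareFree? w ×-dec ∀-splittings? (λ u s → Fin.all? λ c → T? (extensionSquareᵇ u s c)) w)

word : String → Word
word = map (letterOf ∘ (_∸ 97) ∘ Char.toℕ) ∘ toList
  where
  letterOf : ℕ → Γ
  letterOf 0 = zero
  letterOf 1 = suc zero
  letterOf _ = suc (suc zero)
-- Large checks compare only the boolean `does P?` with `true`, so that the proof carried by the
-- decision is not computed.
witness : {P : Set} (P? : Dec P) → does P? ≡ true → P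
witness (yes p) _ = p

-- Exhaustive search for lengths up to 37

module Search (pruneᵇ : Word → Bool) where

  -- The first argument counts the letters that may still be put in front of the word. A word of
  -- listed length passes without a test but is still extended, since its extensions may have
  -- unlisted lengths.
  noExtremalᵇ : ℕ → Word → Bool
  branchᵇ : ℕ → Word → Bool
  noExtremalᵇ zero    w = does (length w ∈? smallLengths) ∨ not (does (extremal? w))
  noExtremalᵇ (suc f) w = (does (length w ∈? smallLengths) ∨ not (does (extremal? w))) ∧
    branchᵇ f (zero ∷ w) ∧ branchᵇ f (suc zero ∷ w) ∧ branchᵇ f (suc (suc zero) ∷ w)
  branchᵇ f w = (hasSquarePrefixᵇ w ∨ pruneᵇ w) ∨ noExtremalᵇ f w

  ∧-conjuncts : ∀ p q r s → p ∧ q ∧ r ∧ s ≡ true → T p × T q × T r × T s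
  ∧-conjuncts true true true true _ = tt , tt , tt , tt

  refuted : ∀ {P Q : Set} (P? : Dec P) (Q? : Dec Q) → T (does P? ∨ not (does Q?)) → ¬ P → ¬ Q
  refuted (yes p) _       _ ¬p = contradiction p ¬p
  refuted (no _)  (no ¬q) _ _  = ¬q

  noExtremal-step : ∀ f w → noExtremalᵇ (suc f) w ≡ true →
    T (does (length w ∈? smallLengths) ∨ not (does (extremal? w))) × (∀ c → T (branchᵇ f (c ∷ w)))
  noExtremal-step f w t
    with ∧-conjuncts (does (length w ∈? smallLengths) ∨ not (does (extremal? w))) (branchᵇ f (zero ∷ w))
           (branchᵇ f (suc zero ∷ w)) (branchᵇ f (suc (suc zero) ∷ w)) t
  ... | here , ta , tb , tc = here , λ { zero → ta ; (suc zero) → tb ; (suc (suc zero)) → tc }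

  noExtremal-here : ∀ f w → noExtremalᵇ f w ≡ true → length w ∉ smallLengths → ¬ ExtremalSquareFree w
  noExtremal-here zero    w t = refuted (length w ∈? smallLengths) (extremal? w) (T-≡ .Equivalence.from t)
  noExtremal-here (suc f) w t = refuted (length w ∈? smallLengths) (extremal? w) (proj₁ (noExtremal-step f w t))

  -- The suffix `w` grows at the front, so the induction removes the last letter of the unknown
  -- prefix `u`. Pruning must be justified for total length `n` only, which lets one search justify
  -- the pruning of another.
  noExtremal-sound : ∀ n → (∀ u v → length (u ++ v) ≡ n → T (pruneᵇ v) → ¬ ExtremalSquareFree (u ++ v)) →
    n ∉ smallLengths → ∀ f w → noExtremalᵇ f w ≡ true →
    ∀ u → length u ≤ f → length (u ++ w) ≡ n → ¬ ExtremalSquareFree (u ++ w)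
  noExtremal-sound n prune ∉small f w t u u≤f ∣uw∣ ext with initLast u
  ... | [] = noExtremal-here f w t (subst (_∉ smallLengths) (sym ∣uw∣) ∉small) ext
  noExtremal-sound n prune ∉small zero w t _ u≤f _ _ | u′ ∷ʳ′ c =
    contradiction (≤-trans (≤-reflexive (sym (trans (length-++ u′) (+-comm (length u′) 1)))) u≤f) λ ()
  noExtremal-sound n prune ∉small (suc f) w t _ u≤f ∣uw∣ ext | u′ ∷ʳ′ c
    with ++-assoc u′ (c ∷ []) w
       | T-∨ {hasSquarePrefixᵇ (c ∷ w) ∨ pruneᵇ (c ∷ w)} .Equivalence.to (proj₂ (noExtremal-step f w t) c)
  ... | eq | inj₂ t′ = noExtremal-sound n prune ∉small f (c ∷ w) (T-≡ .Equivalence.to t′) u′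
    (s≤s⁻¹ (≤-trans (≤-reflexive (sym (trans (length-++ u′) (+-comm (length u′) 1)))) u≤f))
    (trans (cong length (sym eq)) ∣uw∣) (subst ExtremalSquareFree eq ext)
  ... | eq | inj₁ t′ with T-∨ {hasSquarePrefixᵇ (c ∷ w)} .Equivalence.to t′
  ...   | inj₁ sq = circular⇒squareFree (proj₁ ext)
    (subst HasSquare (sym eq) (hasSquare-++ˡ u′ (hasSquarePrefix-sound (c ∷ w) sq)))
  ...   | inj₂ pruned = prune u′ (c ∷ w) (trans (cong length (sym eq)) ∣uw∣) pruned (subst ExtremalSquareFree eq ext)

-- Invariance of extremality under rotation and relabelling

extremal-conjugate : ∀ u s → ExtremalSquareFree (u ++ s) → ExtremalSquareFree (s ++ u)
extremal-conjugate u s (circ , ext) = circular-conjugate u s circ , conjugate-extension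
  where
  conjugate-extension : ∀ v → IsExtension (s ++ u) v → ¬ CircSquareFree v
  -- The insertion point lies in `u` or in `s`; either way the extension rotates to an extension of
  -- `u ++ s`.
  conjugate-extension _ (X , Y , c , eq , refl) circ′ with ++-split s X eq
  ... | inj₁ (q , refl , refl) = ext (q ++ c ∷ Y ++ s) (q , Y ++ s , c , ++-assoc q Y s , refl)
    (subst CircSquareFree (++-assoc q (c ∷ Y) s)
      (circular-conjugate s (q ++ c ∷ Y) (subst CircSquareFree (++-assoc s q (c ∷ Y)) circ′)))
  ... | inj₂ (d , q , refl , refl) = ext (u ++ X ++ c ∷ d ∷ q)
    (u ++ X , d ∷ q , c , sym (++-assoc u X (d ∷ q)) , sym (++-assoc u X (c ∷ d ∷ q)))
    (circular-conjugate (X ++ c ∷ d ∷ q) u (subst CircSquareFree (sym (++-assoc X (c ∷ d ∷ q) u)) circ′))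

map-square : ∀ (f : Γ → Γ) {w} → HasSquare w → HasSquare (map f w)
map-square f (x@(_ ∷ _) , y , z , _ , refl) = map f x , map f y , map f z , (λ ()) , (begin
  map f (y ++ x ++ x ++ z)                 ≡⟨ map-++ f y _ ⟩
  map f y ++ map f (x ++ x ++ z)           ≡⟨ cong (map f y ++_) (map-++ f x _) ⟩
  map f y ++ map f x ++ map f (x ++ z)     ≡⟨ cong (λ v → map f y ++ map f x ++ v) (map-++ f x z) ⟩
  map f y ++ map f x ++ map f x ++ map f z ∎)
  where open ≡-Reasoning
map-square f ([] , _ , _ , []≢[] , _) = contradiction refl []≢[]

map-inverse : ∀ (f g : Γ → Γ) → (∀ c → g (f c) ≡ c) → ∀ w → map g (map f w) ≡ w
map-inverse f g gf w = trans (sym (map-∘ w)) (trans (map-cong gf w) (map-id w))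

circular-map : ∀ (f g : Γ → Γ) → (∀ c → g (f c) ≡ c) → ∀ {w} →
  CircSquareFree w → CircSquareFree (map f w)
circular-map f g gf {w} circ _ (X , Y , eq , refl) sq =
  circ (map g Y ++ map g X)
    (map g X , map g Y , trans (sym (map-inverse f g gf w)) (trans (cong (map g) eq) (map-++ g X Y)) , refl)
    (subst HasSquare (map-++ g Y X) (map-square g sq))

extremal-map : ∀ (f g : Γ → Γ) → (∀ c → g (f c) ≡ c) → (∀ c → f (g c) ≡ c) → ∀ {w} →
  ExtremalSquareFree w → ExtremalSquareFree (map f w)
extremal-map f g gf fg {w} (circ , ext) = circular-map f g gf circ , λ { _ (u , s , c , eq , refl) circ′ →
  ext (map g u ++ g c ∷ map g s)
    (map g u , map g s , g c , trans (sym (map-inverse f g gf w)) (trans (cong (map g) eq) (map-++ g u s)) , refl)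
    (subst CircSquareFree (map-++ g u (c ∷ s)) (circular-map g f fg circ′)) }

relabel : Γ → Γ → Γ → Γ → Γ
relabel p q r zero             = p
relabel p q r (suc zero)       = q
relabel p q r (suc (suc zero)) = r

record Relabelling (x y : Γ) : Set where
  constructor relabelling
  field
    to from   : Γ → Γ
    from∘to   : ∀ c → from (to c) ≡ c
    to∘from   : ∀ c → to (from c) ≡ c
    x↦a       : to x ≡ zero
    y↦b       : to y ≡ suc zero

normalise : ∀ x y → x ≢ y → Relabelling x y
normalise = λ where
    zero             zero             x≢y → contradiction refl x≢y
    zero             (suc zero)       _   → inverses (relabel a b c) (relabel a b c) (refl , refl , refl) (refl , refl , refl) refl refl
    zero             (suc (suc zero)) _   → inverses (relabel a c b) (relabel a c b) (refl , refl , refl) (refl , refl , refl) refl refl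
    (suc zero)       zero             _   → inverses (relabel b a c) (relabel b a c) (refl , refl , refl) (refl , refl , refl) refl refl
    (suc zero)       (suc zero)       x≢y → contradiction refl x≢y
    (suc zero)       (suc (suc zero)) _   → inverses (relabel c a b) (relabel b c a) (refl , refl , refl) (refl , refl , refl) refl refl
    (suc (suc zero)) zero             _   → inverses (relabel b c a) (relabel c a b) (refl , refl , refl) (refl , refl , refl) refl refl
    (suc (suc zero)) (suc zero)       _   → inverses (relabel c b a) (relabel c b a) (refl , refl , refl) (refl , refl , refl) refl refl
    (suc (suc zero)) (suc (suc zero)) x≢y → contradiction refl x≢y
  where
  a b c : Γ
  a = zero
  b = suc zero
  c = suc (suc zero)
  inverses : ∀ f g →
    g (f a) ≡ a × g (f b) ≡ b × g (f c) ≡ c → f (g a) ≡ a × f (g b) ≡ b × f (g c) ≡ c →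
    ∀ {x y} → f x ≡ a → f y ≡ b → Relabelling x y
  inverses f g (p , q , r) (p′ , q′ , r′) = relabelling f g
    (λ { zero → p ; (suc zero) → q ; (suc (suc zero)) → r })
    (λ { zero → p′ ; (suc zero) → q′ ; (suc (suc zero)) → r′ })

-- Up to rotation and relabelling, a circular word either ends with this word or avoids it;
-- other words give larger searches.
pattern-word : Word
pattern-word = word "abacabc"

-- The pattern begins with `ab`, so the first two letters determine the only bijection that could
-- carry the next seven letters to it.
matchesᵇ : Word → Bool
matchesᵇ (x ∷ y ∷ v) with x Fin.≟ y
... | yes _  = false
... | no x≢y = does (≡-dec Fin._≟_ (map (Relabelling.to (normalise x y x≢y)) (x ∷ y ∷ take 5 v)) pattern-word)
matchesᵇ _ = false

holds : {P : Set} (P? : Dec P) → T (does P?) → P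
holds (yes p) _ = p

matches-sound : ∀ v → T (matchesᵇ v) → ∃₂ λ x y → ∃₂ λ (ρ : Relabelling x y) v′ →
  v ≡ map (Relabelling.from ρ) pattern-word ++ v′
matches-sound (x ∷ y ∷ v) t with x Fin.≟ y
... | no x≢y = x , y , ρ , drop 5 v , (begin
  x ∷ y ∷ v                                        ≡⟨ cong (λ v → x ∷ y ∷ v) (take++drop≡id 5 v) ⟨
  (x ∷ y ∷ take 5 v) ++ drop 5 v                   ≡⟨ cong (_++ drop 5 v) (map-inverse to from from∘to _) ⟨
  map from (map to (x ∷ y ∷ take 5 v)) ++ drop 5 v ≡⟨ cong (λ p → map from p ++ drop 5 v) (holds (≡-dec Fin._≟_ (map to (x ∷ y ∷ take 5 v)) pattern-word) t) ⟩
  map from pattern-word ++ drop 5 v                ∎)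
  where
  ρ = normalise x y x≢y
  open Relabelling ρ
  open ≡-Reasoning

never : Word → Bool
never _ = false

-- The seed of length 7 and 30 further letters reach length 37. Nothing is pruned here, as this
-- search justifies the pruning in the next one.
with-pattern : Search.noExtremalᵇ never 30 pattern-word ≡ true
with-pattern = refl

-- Again 2 + 35 = 37. An occurrence of the pattern is a prefix at the moment its first letter is
-- added, so testing prefixes finds every relabelled occurrence.
without-pattern : Search.noExtremalᵇ matchesᵇ 35 (zero ∷ suc zero ∷ []) ≡ true
without-pattern = refl

-- Reduction of all short words to the two searches

length-∷ʳ∷ʳ : ∀ (u : Word) x y → length ((u ∷ʳ x) ∷ʳ y) ≡ 2 + length u
length-∷ʳ∷ʳ u x y = trans (cong length (++-assoc u (x ∷ []) (y ∷ []))) (trans (length-++ u) (+-comm (length u) 2))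

module _ (n : ℕ) (n≤37 : n ≤ 37) (∉small : n ∉ smallLengths) where

  ends-with-pattern : ∀ u → length (u ++ pattern-word) ≡ n → ¬ ExtremalSquareFree (u ++ pattern-word)
  ends-with-pattern u ∣∣ = Search.noExtremal-sound never n (λ _ _ _ ()) ∉small 30 pattern-word with-pattern u
    (+-cancelʳ-≤ 7 (length u) 30 (≤-trans (≤-reflexive (trans (sym (length-++ u)) ∣∣)) n≤37)) ∣∣

  -- Rotation moves the occurrence to the end of the word and relabelling turns it into the pattern
  -- itself.
  contains-pattern : ∀ u v → length (u ++ v) ≡ n → T (matchesᵇ v) → ¬ ExtremalSquareFree (u ++ v)
  contains-pattern u v ∣∣ t ext with matches-sound v t
  ... | x , y , ρ , v′ , refl = ends-with-pattern (map to (v′ ++ u))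
    (trans (cong length (sym map≡)) (trans (length-map to ((v′ ++ u) ++ p)) (trans lengths ∣∣)))
    (subst ExtremalSquareFree map≡ (extremal-map to from from∘to to∘from
      (subst ExtremalSquareFree (sym (++-assoc v′ u p))
        (extremal-conjugate (u ++ p) v′ (subst ExtremalSquareFree (sym (++-assoc u p v′)) ext)))))
    where
    open Relabelling ρ
    p = map from pattern-word
    map≡ : map to ((v′ ++ u) ++ p) ≡ map to (v′ ++ u) ++ pattern-word
    map≡ = trans (map-++ to (v′ ++ u) p) (cong (map to (v′ ++ u) ++_) (map-inverse from to to∘from pattern-word))
    lengths : length ((v′ ++ u) ++ p) ≡ length (u ++ p ++ v′)
    lengths = trans (cong length (++-assoc v′ u p)) (trans (length-++-comm v′ (u ++ p)) (cong length (++-assoc u p v′)))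

  not-extremal : ∀ w → length w ≡ n → ¬ ExtremalSquareFree w
  not-extremal w ∣∣ ext with initLast w
  ... | [] = from-no (extremal? []) ext
  ... | v ∷ʳ′ y with initLast v
  ...   | [] = singleton y ext
    where
    singleton : ∀ y → ¬ ExtremalSquareFree (y ∷ [])
    singleton = from-yes (Fin.all? λ y → ¬? (extremal? (y ∷ [])))
  -- Equal last letters would form a square, so the last two letters can be relabelled to the seed
  -- `ab`.
  ...   | u ∷ʳ′ x with normalise x y (λ { refl → circular⇒squareFree (proj₁ ext)
          (x ∷ [] , u , [] , (λ ()) , ++-assoc u (x ∷ []) (x ∷ [])) })
  ...     | relabelling f g gf fg fx≡a fy≡b = Search.noExtremal-sound matchesᵇ n contains-pattern ∉small 35
    (zero ∷ suc zero ∷ []) without-pattern (map f u)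
    (≤-trans (≤-reflexive (length-map f u)) (s≤s⁻¹ (s≤s⁻¹ (≤-trans (≤-reflexive (trans (sym (length-∷ʳ∷ʳ u x y)) ∣∣)) n≤37))))
    (trans (cong length (sym map≡)) (trans (length-map f ((u ∷ʳ x) ∷ʳ y)) ∣∣))
    (subst ExtremalSquareFree map≡ (extremal-map f g gf fg ext))
    where
    map≡ : map f ((u ∷ʳ x) ∷ʳ y) ≡ map f u ++ zero ∷ suc zero ∷ []
    map≡ = trans (cong (map f) (++-assoc u (x ∷ []) (y ∷ [])))
      (trans (map-++ f u (x ∷ y ∷ [])) (cong₂ (λ c d → map f u ++ c ∷ d ∷ []) fx≡a fy≡b))

short-extremal : ∀ w → ExtremalSquareFree w → length w ≤ 37 → length w ∈ smallLengths
short-extremal w ext ≤37 with length w ∈? smallLengths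
... | yes ∈small = ∈small
... | no  ∉small = contradiction ext (not-extremal (length w) ≤37 ∉small w refl)

-- Substitutions with a marker

∃Factor : Word → Word → Set
∃Factor m x = ∃₂ λ s r → x ≡ s ++ m ++ r

-- By `pre+suf`, a block cut as `p s` has `|p| ≥ pre` or `|s| ≥ suf`, so one part always determines
-- the letter. `synchronised` rules out a marker that starts strictly inside a block, even one that
-- runs on into the next block. `pair-free` excludes squares too short to contain a marker in their
-- root; `another` supplies a neighbour to a block that stands alone. `closed` includes `s = []`,
-- the insertion between two blocks, and excludes `u = []`, which is the same insertion seen from
-- the next block.
record MarkedSubstitution : Set₁ where
  field
    Block   : Set
    letter  : Block → Γ
    marker  : Word
    rest    : Block → Word
    pre suf : ℕ

  image : Block → Word
  image b = marker ++ rest b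

  field
    marker≢[]     : marker ≢ []
    0<pre         : 0 < pre
    0<suf         : 0 < suf
    pre+suf       : ∀ b → pre + suf ≤ suc (length (image b))
    synchronised  : ∀ b u s z → image b ≡ u ++ s → u ≢ [] → s ≢ [] → s ++ marker ≢ marker ++ z
    prefix-free   : ∀ b c t → image c ≡ image b ++ t → t ≡ []
    prefix-letter : ∀ b c x s t → length x ≡ pre → image b ≡ x ++ s → image c ≡ x ++ t → letter b ≡ letter c
    suffix-letter : ∀ b c x s t → length x ≡ suf → image b ≡ s ++ x → image c ≡ t ++ x → letter b ≡ letter c
    pair-free     : ∀ b c → letter b ≢ letter c → SquareFree (image b ++ image c ++ marker)
    another       : Block → Block
    another≢      : ∀ b → letter b ≢ letter (another b)
    closed        : ∀ b u s c → image b ≡ u ++ s → u ≢ [] → HasSquare (u ++ c ∷ s ++ marker)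

-- Decoding images: from squares in the image to squares of letters

module Images (σ : MarkedSubstitution) where
  open MarkedSubstitution σ

  ⟦_⟧ : List Block → Word
  ⟦_⟧ = concatMap image

  ⟦⟧-++ : ∀ V W → ⟦ V ++ W ⟧ ≡ ⟦ V ⟧ ++ ⟦ W ⟧
  ⟦⟧-++ = concatMap-++ image

  ⟦∷⟧ : ∀ b W → ⟦ b ∷ W ⟧ ≡ marker ++ rest b ++ ⟦ W ⟧
  ⟦∷⟧ b W = ++-assoc marker (rest b) ⟦ W ⟧

  marker-++≢[] : ∀ r → marker ++ r ≢ []
  marker-++≢[] r eq = marker≢[] (++-conicalˡ marker r eq)

  ++-≢[] : ∀ (u : Word) {c v} → u ++ c ∷ v ≢ []
  ++-≢[] [] ()
  ++-≢[] (_ ∷ _) ()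

  ∷-≢[] : ∀ {c : Γ} {v} → c ∷ v ≢ []
  ∷-≢[] ()

  image≢[] : ∀ b → image b ≢ []
  image≢[] b = marker-++≢[] (rest b)

  ⟦⟧≡[] : ∀ W → ⟦ W ⟧ ≡ [] → W ≡ []
  ⟦⟧≡[] []      _  = refl
  ⟦⟧≡[] (b ∷ W) eq = contradiction (++-conicalˡ (image b) ⟦ W ⟧ eq) (image≢[] b)

  -- An occurrence that starts inside a block, at its suffix `s`, is compared with `s ++ marker`:
  -- the marker is the beginning of the next block, or is appended if there is none. Then
  -- `synchronised` applies.
  marker-boundary : ∀ W u r → ⟦ W ⟧ ≡ u ++ marker ++ r →
    ∃₂ λ W₁ W₂ → W ≡ W₁ ++ W₂ × ⟦ W₁ ⟧ ≡ u × ⟦ W₂ ⟧ ≡ marker ++ r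
  marker-boundary [] u r eq = contradiction (++-conicalʳ u _ (sym eq)) (marker-++≢[] r)
  marker-boundary (b ∷ W) u r eq with ++-split (image b) u eq
  ... | inj₁ (q , refl , eq′) with marker-boundary W q r eq′
  ...   | W₁ , W₂ , refl , refl , eq″ = b ∷ W₁ , W₂ , refl , refl , eq″
  marker-boundary (b ∷ W) [] r eq | inj₂ _ = [] , b ∷ W , refl , refl , eq
  marker-boundary (b ∷ W) (d ∷ u) r eq | inj₂ (c , q , b≡ , eq′) =
    contradiction (proj₂ (overlapping W eq′)) (synchronised b (d ∷ u) (c ∷ q) _ b≡ ∷-≢[] ∷-≢[])
    where
    overlapping : ∀ W → marker ++ r ≡ (c ∷ q) ++ ⟦ W ⟧ → ∃ λ z → (c ∷ q) ++ marker ≡ marker ++ z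
    overlapping [] eq = r ++ marker , (begin
      (c ∷ q) ++ marker        ≡⟨ cong (_++ marker) (++-identityʳ (c ∷ q)) ⟨
      ((c ∷ q) ++ []) ++ marker ≡⟨ cong (_++ marker) eq ⟨
      (marker ++ r) ++ marker  ≡⟨ ++-assoc marker r marker ⟩
      marker ++ r ++ marker    ∎)
      where open ≡-Reasoning
    overlapping (e ∷ W) eq with ++-split-≤ marker ((c ∷ q) ++ marker)
      (≤-trans (m≤n+m _ (length (c ∷ q))) (≤-reflexive (sym (length-++ (c ∷ q)))))
      (trans eq (trans (cong ((c ∷ q) ++_) (⟦∷⟧ e W)) (sym (++-assoc (c ∷ q) marker _))))
    ... | z , eq′ , _ = z , eq′

  Adjacent : List Block → Set
  Adjacent W = ∀ Y b c Z → W ≡ Y ++ b ∷ c ∷ Z → letter b ≢ letter c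

  adjacent-tail : ∀ {b W} → Adjacent (b ∷ W) → Adjacent W
  adjacent-tail {b} adj Y c d Z eq = adj (b ∷ Y) c d Z (cong (b ∷_) eq)

  -- Let the square start in the block `b`, before its suffix `s`. If it ends no later than the
  -- marker after the next block `c`, it contradicts `pair-free`; otherwise it covers that marker
  -- and the one that opens `c`.
  square-root-marked : ∀ W y x z → Adjacent W → x ≢ [] → ⟦ W ⟧ ≡ y ++ x ++ x ++ z → ∃Factor marker x
  square-root-marked [] y x z adj x≢[] eq =
    contradiction (++-conicalˡ x _ (++-conicalʳ y _ (sym eq))) x≢[]
  square-root-marked (b ∷ W) y x z adj x≢[] eq with ++-split (image b) y eq
  ... | inj₁ (q , refl , eq′) = square-root-marked W q x z (adjacent-tail adj) x≢[] eq′
  square-root-marked (b ∷ []) y x z adj x≢[] eq | inj₂ (e , s , b≡ , eq′) =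
    contradiction
      (subst (λ u → HasSquare (u ++ image (another b) ++ marker))
        (trans (sym eq) (++-identityʳ (image b)))
        (hasSquare-++ʳ _ (x , y , z , x≢[] , refl)))
      (pair-free b (another b) (another≢ b))
  square-root-marked (b ∷ c ∷ W) y x z adj x≢[] eq | inj₂ (e , s′ , b≡ , eq′) = found
    where
    s = e ∷ s′
    window : Word
    window = s ++ image c ++ marker
    window-free : ∀ q → window ≢ x ++ x ++ q
    window-free q eq = pair-free b c (adj [] b c W refl)
      (x , y , q , x≢[] , (begin
        image b ++ image c ++ marker    ≡⟨ cong (_++ image c ++ marker) b≡ ⟩
        (y ++ s) ++ image c ++ marker   ≡⟨ ++-assoc y s _ ⟩
        y ++ window                     ≡⟨ cong (y ++_) eq ⟩
        y ++ x ++ x ++ q                ∎))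
      where open ≡-Reasoning
    overhang : ∀ W → x ++ x ++ z ≡ s ++ image c ++ ⟦ W ⟧ →
      (∃ λ q → window ≡ (x ++ x) ++ q) ⊎ (∃ λ q → x ++ x ≡ window ++ q)
    overhang [] eq = inj₁ (z ++ marker , (begin
      s ++ image c ++ marker            ≡⟨ ++-solve 3 (λ s c m → s ⊕ c ⊕ m ⊜ (s ⊕ c ⊕ nil) ⊕ m) refl s (image c) marker ⟩
      (s ++ image c ++ []) ++ marker    ≡⟨ cong (_++ marker) eq ⟨
      (x ++ x ++ z) ++ marker           ≡⟨ ++-solve 3 (λ x z m → (x ⊕ x ⊕ z) ⊕ m ⊜ (x ⊕ x) ⊕ z ⊕ m) refl x z marker ⟩
      (x ++ x) ++ z ++ marker           ∎))
      where open ≡-Reasoning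
    overhang (d ∷ W) eq with ++-split (x ++ x) window (trans (++-assoc x x z) (trans eq (begin
      s ++ image c ++ ⟦ d ∷ W ⟧                  ≡⟨ cong (λ v → s ++ image c ++ v) (⟦∷⟧ d W) ⟩
      s ++ image c ++ marker ++ rest d ++ ⟦ W ⟧  ≡⟨ ++-solve 4 (λ s c m r → s ⊕ c ⊕ m ⊕ r ⊜ (s ⊕ c ⊕ m) ⊕ r) refl s (image c) marker (rest d ++ ⟦ W ⟧) ⟩
      window ++ rest d ++ ⟦ W ⟧                  ∎)))
      where open ≡-Reasoning
    ... | inj₁ (q , window≡ , _) = inj₁ (q , window≡)
    ... | inj₂ (c , q , xx≡ , _) = inj₂ (c ∷ q , xx≡)
    -- If x x covers window, its midpoint cuts at most one of the two markers in window.
    found : ∃Factor marker x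
    found with overhang W eq′
    ... | inj₁ (q , eq″) = contradiction (trans eq″ (++-assoc x x q)) (window-free q)
    ... | inj₂ (q , eq″) with ++-split x (s ++ marker) (trans eq″
      (++-solve 4 (λ s m r q → (s ⊕ (m ⊕ r) ⊕ m) ⊕ q ⊜ (s ⊕ m) ⊕ r ⊕ m ⊕ q) refl s marker (rest c) q))
    ...   | inj₁ (t , _ , x≡) = t ++ rest c , q , trans x≡ (sym (++-assoc t (rest c) _))
    ...   | inj₂ (d , t , x≡ , _) = s , d ∷ t , trans x≡ (++-assoc s marker _)

  -- A cut between two blocks is assigned to the end of the left one, so that `p` is never empty.
  -- This makes the length estimate `short` strict, and it is the form in which `closed` is applied.
  split-prefix : ∀ W u v → u ≢ [] → ⟦ W ⟧ ≡ u ++ v →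
    ∃₂ λ P b → ∃ λ T → ∃₂ λ p s →
      W ≡ P ++ b ∷ T × u ≡ ⟦ P ⟧ ++ p × image b ≡ p ++ s × v ≡ s ++ ⟦ T ⟧ × p ≢ []
  split-prefix [] u v u≢[] eq = contradiction (++-conicalˡ u v (sym eq)) u≢[]
  split-prefix (b ∷ W) u v u≢[] eq with ++-split (image b) u eq
  ... | inj₂ (c , q , b≡ , v≡) = [] , b , W , u , c ∷ q , refl , refl , b≡ , v≡ , u≢[]
  ... | inj₁ ([] , u≡ , v≡) = [] , b , W , image b , [] , refl ,
    trans u≡ (++-identityʳ (image b)) , sym (++-identityʳ (image b)) , sym v≡ , image≢[] b
  ... | inj₁ (q@(_ ∷ _) , refl , eq′) with split-prefix W q v ∷-≢[] eq′
  ...   | P , b′ , T , p , s , refl , q≡ , b′≡ , v≡ , p≢[] =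
    b ∷ P , b′ , T , p , s , refl , trans (cong (image b ++_) q≡) (sym (++-assoc (image b) ⟦ P ⟧ p)) , b′≡ , v≡ , p≢[]

  pre≤ : ∀ b → pre ≤ length (image b)
  pre≤ b = s≤s⁻¹ (begin
    suc pre   ≡⟨ +-comm 1 pre ⟩
    pre + 1   ≤⟨ +-monoʳ-≤ pre 0<suf ⟩
    pre + suf ≤⟨ pre+suf b ⟩
    suc (length (image b)) ∎)
    where open ≤-Reasoning

  suf≤ : ∀ b → suf ≤ length (image b)
  suf≤ b = s≤s⁻¹ (≤-trans (+-monoˡ-≤ suf 0<pre) (pre+suf b))

  cut : ∀ k (u : Word) → k ≤ length u → ∃₂ λ x v → length x ≡ k × u ≡ x ++ v
  cut k u k≤u = take k u , drop k u , trans (length-take k u) (m≤n⇒m⊓n≡m k≤u) , sym (take++drop≡id k u)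

  image-letter : ∀ b c → image b ≡ image c → letter b ≡ letter c
  image-letter b c eq with cut pre (image b) (pre≤ b)
  ... | x , v , ∣x∣ , b≡ = prefix-letter b c x v v ∣x∣ b≡ (trans (sym eq) b≡)

  cut-last : ∀ k (u : Word) → k ≤ length u → ∃₂ λ x v → length x ≡ k × u ≡ v ++ x
  cut-last k u k≤u = drop j u , take j u ,
    trans (length-drop j u) (m∸[m∸n]≡n k≤u) , sym (take++drop≡id j u)
    where j = length u ∸ k

  -- Blocks with equal images are not assumed equal, so decoding recovers images and letters rather
  -- than the blocks themselves.
  decode : ∀ P W v → ⟦ W ⟧ ≡ ⟦ P ⟧ ++ v →
    ∃₂ λ P′ W′ → W ≡ P′ ++ W′ × map letter P′ ≡ map letter P × ⟦ P′ ⟧ ≡ ⟦ P ⟧ × ⟦ W′ ⟧ ≡ v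
  decode [] W v eq = [] , W , refl , refl , refl , eq
  decode (b ∷ P) [] v eq = contradiction (++-conicalˡ (image b) _ (++-conicalˡ _ v (sym eq))) (image≢[] b)
  decode (b ∷ P) (c ∷ W) v eq with same-image (trans eq (++-assoc (image b) ⟦ P ⟧ v))
    where
    same-image : image c ++ ⟦ W ⟧ ≡ image b ++ ⟦ P ⟧ ++ v → image c ≡ image b × ⟦ W ⟧ ≡ ⟦ P ⟧ ++ v
    same-image eq with ++-split (image c) (image b) eq
    ... | inj₁ (q , b≡ , W≡) with prefix-free c b q b≡
    ...   | refl = trans (sym (++-identityʳ (image c))) (sym b≡) , W≡
    same-image eq | inj₂ (d , q , c≡ , _) with prefix-free b c (d ∷ q) c≡
    ... | ()
  ... | c≡b , W≡ with decode P W v W≡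
  ...   | P′ , W′ , refl , letters , images , rest≡ =
    c ∷ P′ , W′ , refl , cong₂ _∷_ (image-letter c b c≡b) letters , cong₂ _++_ c≡b images , rest≡

  -- A prefix-free code is decoded from the left; the marker at the start of `⟦ T ⟧` shows where to
  -- begin.
  decode-suffix : ∀ T W u → ⟦ W ⟧ ≡ u ++ ⟦ T ⟧ →
    ∃₂ λ W′ T′ → W ≡ W′ ++ T′ × map letter T′ ≡ map letter T × ⟦ T′ ⟧ ≡ ⟦ T ⟧ × ⟦ W′ ⟧ ≡ u
  decode-suffix [] W u eq = W , [] , sym (++-identityʳ W) , refl , refl , trans eq (++-identityʳ u)
  decode-suffix T@(t ∷ T₀) W u eq with marker-boundary W u (rest t ++ ⟦ T₀ ⟧) (trans eq (cong (u ++_) (⟦∷⟧ t T₀)))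
  ... | W′ , T₁ , refl , W′≡ , T₁≡ with decode T T₁ [] (trans T₁≡ (sym (trans (++-identityʳ ⟦ T ⟧) (⟦∷⟧ t T₀))))
  ...   | T′ , T″ , refl , letters , images , T″≡ with ⟦⟧≡[] T″ T″≡
  ...     | refl = W′ , T′ ++ [] , refl , trans (cong (map letter) (++-identityʳ T′)) letters ,
                   trans (cong ⟦_⟧ (++-identityʳ T′)) images , W′≡

  first-letter : ∀ b W x s v → length x ≡ pre → image b ≡ x ++ s → ⟦ W ⟧ ≡ x ++ v →
    ∃₂ λ c W′ → W ≡ c ∷ W′ × letter c ≡ letter b
  first-letter b [] x s v ∣x∣ b≡ eq =
    contradiction (≤-trans 0<pre (≤-reflexive (trans (sym ∣x∣) (cong length (++-conicalˡ x v (sym eq)))))) λ ()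
  first-letter b (c ∷ W) x s v ∣x∣ b≡ eq
    with ++-split-≤ x (image c) (≤-trans (≤-reflexive ∣x∣) (pre≤ c)) (sym eq)
  ... | t , c≡ , _ = c , W , refl , prefix-letter c b x t s ∣x∣ c≡ b≡

  last-letter : ∀ b W x s v → length x ≡ suf → image b ≡ s ++ x → ⟦ W ⟧ ≡ v ++ x →
    ∃₂ λ W′ c → W ≡ W′ ∷ʳ c × letter c ≡ letter b
  last-letter b W x s v ∣x∣ b≡ eq with initLast W
  ... | [] = contradiction (≤-trans 0<suf (≤-reflexive (trans (sym ∣x∣) (cong length (++-conicalʳ v x (sym eq)))))) λ ()
  ... | W′ ∷ʳ′ c = W′ , c , refl , ends (++-split v ⟦ W′ ⟧ (trans (sym eq)
          (trans (⟦⟧-++ W′ (c ∷ [])) (cong (⟦ W′ ⟧ ++_) (++-identityʳ (image c))))))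
    where
    ends : (∃ λ q → ⟦ W′ ⟧ ≡ v ++ q × x ≡ q ++ image c) ⊎ (∃₂ λ d q → v ≡ ⟦ W′ ⟧ ++ d ∷ q × image c ≡ d ∷ q ++ x) →
      letter c ≡ letter b
    ends (inj₂ (d , q , _ , c≡)) = suffix-letter c b x (d ∷ q) s ∣x∣ c≡ b≡
    ends (inj₁ ([] , _ , x≡)) = suffix-letter c b x [] s ∣x∣ (sym x≡) b≡
    ends (inj₁ (d ∷ q , _ , x≡)) = contradiction
      (≤-trans (≤-reflexive (trans (cong length (sym x≡)) ∣x∣)) (suf≤ c))
      (<⇒≱ (s≤s (≤-trans (m≤n+m _ (length q)) (≤-reflexive (sym (length-++ q))))))

  -- The blocks in `middle` supply all letters of the square except one, which comes from the block
  -- just before or just after them. Only `middle` is bounded in length, because that additional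
  -- block may extend beyond the square in the image.
  record LetterSquare (W : List Block) (n : ℕ) : Set where
    constructor letterSquare
    field
      left middle right : List Block
      split             : W ≡ left ++ middle ++ right
      short             : length ⟦ middle ⟧ < n
      before root after : Word
      root≢[]           : root ≢ []
      length-root       : length root + length root ≡ suc (length middle)
      factor            : map letter W ≡ before ++ root ++ root ++ after

  -- Cut W at the two occurrences of the marker in x x, so that the second part V has
  -- an image conjugate to x. The block b of V that contains the seam between the two
  -- copies of x agrees either with the first block after V or with the last one before
  -- it, in more letters than two blocks with different letters can share.
  square-descends : ∀ W y x z → Adjacent W → x ≢ [] → ⟦ W ⟧ ≡ y ++ x ++ x ++ z →
    LetterSquare W (length x + length x)
  square-descends W y x z adj x≢[] eq with square-root-marked W y x z adj x≢[] eq
  ... | s , r , refl with marker-boundary W (y ++ s) (r ++ s ++ marker ++ r ++ z)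
      (trans eq (++-solve 5 (λ y s m r z → y ⊕ (s ⊕ m ⊕ r) ⊕ (s ⊕ m ⊕ r) ⊕ z ⊜ (y ⊕ s) ⊕ m ⊕ r ⊕ s ⊕ m ⊕ r ⊕ z)
        refl y s marker r z))
  ...   | W₁ , W₂ , refl , W₁≡ , W₂≡ with marker-boundary W₂ (marker ++ r ++ s) (r ++ z)
      (trans W₂≡ (++-solve 4 (λ s m r z → m ⊕ r ⊕ s ⊕ m ⊕ r ⊕ z ⊜ (m ⊕ r ⊕ s) ⊕ m ⊕ r ⊕ z) refl s marker r z))
  ...     | V , W₄ , refl , V≡ , W₄≡ with split-prefix V (marker ++ r) s (marker-++≢[] r)
      (trans V≡ (sym (++-assoc marker r s)))
  ...       | P , b , T , p , s′ , refl , P≡ , b≡ , refl , p≢[]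
      with decode P W₄ (p ++ z) (trans W₄≡ (trans (sym (++-assoc marker r z))
             (trans (cong (_++ z) P≡) (++-assoc ⟦ P ⟧ p z))))
         | decode-suffix T W₁ (y ++ s′) (trans W₁≡ (sym (++-assoc y s′ ⟦ T ⟧)))
  ...         | P′ , W₄′ , refl , letterP′ , imageP′ , W₄′≡ | W₁′ , T′ , refl , letterT′ , imageT′ , W₁′≡ =
    [ after-seam , before-seam ]′ (≤-<-connex pre (length p))
    where
    F = T′ ++ (P ++ b ∷ T) ++ P′
    t = map letter T
    π = map letter P
    β = letter b

    split≡ : (W₁′ ++ T′) ++ (P ++ b ∷ T) ++ P′ ++ W₄′ ≡ W₁′ ++ F ++ W₄′
    split≡ = begin
      (W₁′ ++ T′) ++ (P ++ b ∷ T) ++ P′ ++ W₄′   ≡⟨ ++-assoc W₁′ T′ _ ⟩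
      W₁′ ++ T′ ++ (P ++ b ∷ T) ++ P′ ++ W₄′     ≡⟨ cong (λ U → W₁′ ++ T′ ++ U) (++-assoc (P ++ b ∷ T) P′ W₄′) ⟨
      W₁′ ++ T′ ++ ((P ++ b ∷ T) ++ P′) ++ W₄′   ≡⟨ cong (W₁′ ++_) (++-assoc T′ _ W₄′) ⟨
      W₁′ ++ F ++ W₄′                            ∎
      where open ≡-Reasoning

    letterF : map letter F ≡ t ++ (π ++ β ∷ t) ++ π
    letterF = begin
      map letter F                                                        ≡⟨ map-++ letter T′ _ ⟩
      map letter T′ ++ map letter ((P ++ b ∷ T) ++ P′)                    ≡⟨ cong (map letter T′ ++_) (map-++ letter (P ++ b ∷ T) P′) ⟩
      map letter T′ ++ map letter (P ++ b ∷ T) ++ map letter P′           ≡⟨ cong (λ u → map letter T′ ++ u ++ map letter P′) (map-++ letter P (b ∷ T)) ⟩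
      map letter T′ ++ (π ++ β ∷ t) ++ map letter P′                      ≡⟨ cong₂ (λ u v → u ++ (π ++ β ∷ t) ++ v) letterT′ letterP′ ⟩
      t ++ (π ++ β ∷ t) ++ π                                              ∎
      where open ≡-Reasoning

    letters≡ : map letter ((W₁′ ++ T′) ++ (P ++ b ∷ T) ++ P′ ++ W₄′) ≡
      map letter W₁′ ++ (t ++ (π ++ β ∷ t) ++ π) ++ map letter W₄′
    letters≡ = begin
      map letter ((W₁′ ++ T′) ++ (P ++ b ∷ T) ++ P′ ++ W₄′)  ≡⟨ cong (map letter) split≡ ⟩
      map letter (W₁′ ++ F ++ W₄′)                           ≡⟨ map-++ letter W₁′ _ ⟩
      map letter W₁′ ++ map letter (F ++ W₄′)                ≡⟨ cong (map letter W₁′ ++_) (map-++ letter F W₄′) ⟩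
      map letter W₁′ ++ map letter F ++ map letter W₄′       ≡⟨ cong (λ u → map letter W₁′ ++ u ++ map letter W₄′) letterF ⟩
      _                                                      ∎
      where open ≡-Reasoning

    length-F : length (t ++ (π ++ β ∷ t) ++ π) ≡ length F
    length-F = trans (cong length (sym letterF)) (length-map letter F)

    X = (s′ ++ ⟦ T ⟧) ++ marker ++ r

    length-X : length X ≡ length ⟦ P ++ b ∷ T ⟧
    length-X = begin
      length X                                    ≡⟨ length-++-comm (s′ ++ ⟦ T ⟧) (marker ++ r) ⟩
      length ((marker ++ r) ++ s′ ++ ⟦ T ⟧)       ≡⟨ cong length (++-assoc marker r _) ⟩
      length (marker ++ r ++ s′ ++ ⟦ T ⟧)         ≡⟨ cong length V≡ ⟨
      length ⟦ P ++ b ∷ T ⟧                       ∎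
      where open ≡-Reasoning

    short : length ⟦ F ⟧ < length X + length X
    short = begin-strict
      length ⟦ F ⟧                                                 ≡⟨ cong length (trans (⟦⟧-++ T′ _) (cong (⟦ T′ ⟧ ++_) (⟦⟧-++ (P ++ b ∷ T) P′))) ⟩
      length (⟦ T′ ⟧ ++ ⟦ P ++ b ∷ T ⟧ ++ ⟦ P′ ⟧)                  ≡⟨ cong₂ (λ u v → length (u ++ ⟦ P ++ b ∷ T ⟧ ++ v)) imageT′ imageP′ ⟩
      length (⟦ T ⟧ ++ ⟦ P ++ b ∷ T ⟧ ++ ⟦ P ⟧)                    ≡⟨ trans (length-++ ⟦ T ⟧) (cong (length ⟦ T ⟧ +_) (length-++ ⟦ P ++ b ∷ T ⟧)) ⟩
      length ⟦ T ⟧ + (length ⟦ P ++ b ∷ T ⟧ + length ⟦ P ⟧)        ≡⟨ cong (λ n → length ⟦ T ⟧ + (n + length ⟦ P ⟧)) length-X ⟨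
      length ⟦ T ⟧ + (length X + length ⟦ P ⟧)                     <⟨ +-monoʳ-< (length ⟦ T ⟧) (+-monoʳ-< (length X) (m<m+n (length ⟦ P ⟧) (0<length p≢[]))) ⟩
      length ⟦ T ⟧ + (length X + (length ⟦ P ⟧ + length p))        ≡⟨ cong (λ n → length ⟦ T ⟧ + (length X + n)) (trans (cong length P≡) (length-++ ⟦ P ⟧)) ⟨
      length ⟦ T ⟧ + (length X + length (marker ++ r))             ≤⟨ +-monoˡ-≤ _ (≤-trans (m≤n+m _ (length s′)) (≤-reflexive (sym (length-++ s′)))) ⟩
      length (s′ ++ ⟦ T ⟧) + (length X + length (marker ++ r))     ≡⟨ x∙yz≈y∙xz (length (s′ ++ ⟦ T ⟧)) (length X) _ ⟩
      length X + (length (s′ ++ ⟦ T ⟧) + length (marker ++ r))     ≡⟨ cong (length X +_) (length-++ (s′ ++ ⟦ T ⟧)) ⟨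
      length X + length X                                          ∎
      where
      open ≤-Reasoning
      open CommutativeSemigroup +-commutativeSemigroup using (x∙yz≈y∙xz)
      0<length : ∀ {u : Word} → u ≢ [] → 0 < length u
      0<length {[]}    []≢[] = contradiction refl []≢[]
      0<length {_ ∷ _} _     = z<s

    after-seam : pre ≤ length p → LetterSquare _ _
    after-seam long with cut pre p long
    ... | x₀ , p′ , ∣x₀∣ , refl with first-letter b W₄′ x₀ (p′ ++ s′) (p′ ++ z) ∣x₀∣
        (trans b≡ (++-assoc x₀ p′ s′)) (trans W₄′≡ (++-assoc x₀ p′ z))
    ...   | c , W₅ , refl , c≡β = letterSquare W₁′ F (c ∷ W₅) split≡ short
        (map letter W₁′) v (map letter W₅) (++-≢[] π ∘ ++-conicalʳ t _) length-v
        (trans letters≡ (trans (cong (λ e → map letter W₁′ ++ (t ++ (π ++ β ∷ t) ++ π) ++ e ∷ map letter W₅) c≡β)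
          (++-solve 5 (λ w t π β w′ → w ⊕ (t ⊕ (π ⊕ β ⊕ t) ⊕ π) ⊕ β ⊕ w′ ⊜ w ⊕ (t ⊕ π ⊕ β) ⊕ (t ⊕ π ⊕ β) ⊕ w′)
            refl (map letter W₁′) t π (β ∷ []) (map letter W₅))))
      where
      v = t ++ π ++ β ∷ []
      length-v : length v + length v ≡ suc (length F)
      length-v = begin
        length v + length v                              ≡⟨ length-++ v ⟨
        length (v ++ v)                                  ≡⟨ cong length (++-solve 3 (λ t π β → (t ⊕ π ⊕ β) ⊕ t ⊕ π ⊕ β ⊜ (t ⊕ (π ⊕ β ⊕ t) ⊕ π) ⊕ β) refl t π (β ∷ [])) ⟩
        length ((t ++ (π ++ β ∷ t) ++ π) ++ β ∷ [])      ≡⟨ length-++ (t ++ (π ++ β ∷ t) ++ π) ⟩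
        length (t ++ (π ++ β ∷ t) ++ π) + 1              ≡⟨ +-comm _ 1 ⟩
        suc (length (t ++ (π ++ β ∷ t) ++ π))            ≡⟨ cong suc length-F ⟩
        suc (length F)                                   ∎
        where open ≡-Reasoning

    before-seam : length p < pre → LetterSquare _ _
    before-seam short′ with cut-last suf s′ suf≤s′
      where
      suf≤s′ : suf ≤ length s′
      suf≤s′ = +-cancelˡ-≤ (suc (length p)) suf (length s′) (begin
        suc (length p) + suf        ≤⟨ +-monoˡ-≤ suf short′ ⟩
        pre + suf                   ≤⟨ pre+suf b ⟩
        suc (length (image b))      ≡⟨ cong suc (trans (cong length b≡) (length-++ p)) ⟩
        suc (length p) + length s′  ∎)
        where open ≤-Reasoning
    ... | x₀ , s₀ , ∣x₀∣ , refl with last-letter b W₁′ x₀ (p ++ s₀) (y ++ s₀) ∣x₀∣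
        (trans b≡ (sym (++-assoc p s₀ x₀))) (trans W₁′≡ (sym (++-assoc y s₀ x₀)))
    ...   | W₀ , c , refl , c≡β = letterSquare (W₀ ∷ʳ c) F W₄′ split≡ short
        (map letter W₀) v (map letter W₄′) ∷-≢[] length-v
        (trans letters≡ (trans
          (cong (_++ (t ++ (π ++ β ∷ t) ++ π) ++ map letter W₄′)
            (trans (map-++ letter W₀ (c ∷ [])) (cong (λ e → map letter W₀ ++ e ∷ []) c≡β)))
          (++-solve 5 (λ w t π β w′ → (w ⊕ β) ⊕ (t ⊕ (π ⊕ β ⊕ t) ⊕ π) ⊕ w′ ⊜ w ⊕ (β ⊕ t ⊕ π) ⊕ (β ⊕ t ⊕ π) ⊕ w′)
            refl (map letter W₀) t π (β ∷ []) (map letter W₄′))))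
      where
      v = β ∷ t ++ π
      length-v : length v + length v ≡ suc (length F)
      length-v = begin
        length v + length v                     ≡⟨ length-++ v ⟨
        length (v ++ v)                         ≡⟨ cong (suc ∘ length) (++-solve 3 (λ t π β → (t ⊕ π) ⊕ β ⊕ t ⊕ π ⊜ t ⊕ (π ⊕ β ⊕ t) ⊕ π) refl t π (β ∷ [])) ⟩
        suc (length (t ++ (π ++ β ∷ t) ++ π))   ≡⟨ cong suc length-F ⟩
        suc (length F)                          ∎
        where open ≡-Reasoning

  -- A factor of w w that is at least as long as w contains a conjugate of w.
  wraps : ∀ w Y F Z → w ++ w ≡ Y ++ F ++ Z → length w ≤ length F → length ⟦ w ⟧ ≤ length ⟦ F ⟧
  wraps w Y F Z eq w≤F with ++-split-≤ Y w Y≤w (sym eq)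
    where
    Y≤w : length Y ≤ length w
    Y≤w = +-cancelʳ-≤ (length w) (length Y) (length w) (begin
      length Y + length w                ≤⟨ +-monoʳ-≤ (length Y) w≤F ⟩
      length Y + length F                ≤⟨ +-monoʳ-≤ (length Y) (m≤m+n _ (length Z)) ⟩
      length Y + (length F + length Z)   ≡⟨ trans (length-++ Y) (cong (length Y +_) (length-++ F)) ⟨
      length (Y ++ F ++ Z)               ≡⟨ cong length eq ⟨
      length (w ++ w)                    ≡⟨ length-++ w ⟩
      length w + length w                ∎)
      where open ≤-Reasoning
  ... | q , refl , eq′ with ++-split-≤ (q ++ Y) F
      (≤-trans (≤-reflexive (length-++-comm q Y)) w≤F) (trans (++-assoc q Y q) (sym eq′))
  ...   | t , refl , _ = begin
    length ⟦ Y ++ q ⟧             ≡⟨ cong length (⟦⟧-++ Y q) ⟩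
    length (⟦ Y ⟧ ++ ⟦ q ⟧)       ≡⟨ length-++-comm ⟦ Y ⟧ ⟦ q ⟧ ⟩
    length (⟦ q ⟧ ++ ⟦ Y ⟧)       ≡⟨ cong length (⟦⟧-++ q Y) ⟨
    length ⟦ q ++ Y ⟧             ≤⟨ m≤m+n _ (length ⟦ t ⟧) ⟩
    length ⟦ q ++ Y ⟧ + length ⟦ t ⟧ ≡⟨ trans (cong length (⟦⟧-++ (q ++ Y) t)) (length-++ ⟦ q ++ Y ⟧) ⟨
    length ⟦ (q ++ Y) ++ t ⟧      ∎
    where open ≤-Reasoning

  -- The square of letters must be short enough to lie in a conjugate. If `F` had at least `|w|`
  -- blocks, its image would be at least as long as `⟦ w ⟧`, against `short`; hence `|F| + 1 ≤ |w|`,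
  -- and this is the length of the square of letters.
  circular-image : ∀ w → 2 ≤ length w → CircSquareFree (map letter w) → CircSquareFree ⟦ w ⟧
  circular-image w 2≤w circ = ¬repeats⇒circular λ (repeats y x z x≢[] fits eq) →
    from-letters fits (square-descends (w ++ w) y x z adjacent x≢[] (trans (⟦⟧-++ w w) eq))
    where
    ¬rep : ∀ before r after → r ≢ [] → length r + length r ≤ length w →
      map letter (w ++ w) ≢ before ++ r ++ r ++ after
    ¬rep before r after r≢[] fits eq = circular⇒¬repeats circ
      (repeats before r after r≢[] (≤-trans fits (≤-reflexive (sym (length-map letter w))))
        (trans (sym (map-++ letter w w)) eq))
    adjacent : Adjacent (w ++ w)
    adjacent Y b c Z eq b≡c = ¬rep (map letter Y) (letter b ∷ []) (map letter Z) ∷-≢[] 2≤w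
      (trans (cong (map letter) eq) (trans (map-++ letter Y _)
        (cong (λ e → map letter Y ++ letter b ∷ e ∷ map letter Z) (sym b≡c))))
    from-letters : ∀ {n} → n ≤ length ⟦ w ⟧ → LetterSquare (w ++ w) n → ⊥
    from-letters n≤ (letterSquare Y F Z eq short before r after r≢[] length-r letters≡) =
      ¬rep before r after r≢[] (≤-trans (≤-reflexive length-r) F<w) letters≡
      where
      F<w : length F < length w
      F<w = ≰⇒> λ w≤F → <⇒≱ (≤-trans short n≤) (wraps w Y F Z eq w≤F)

  -- Rotating the changed block to the front puts another block behind it, since there are at least
  -- two, and that block supplies the marker required by `closed`.
  extremal-image : ∀ w → 2 ≤ length w → CircSquareFree (map letter w) → ExtremalSquareFree ⟦ w ⟧
  extremal-image w 2≤w circ = circular-image w 2≤w circ , extension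
    where
    nonempty : ∀ V → 1 ≤ length V → ∃ λ r → ⟦ V ⟧ ≡ marker ++ r
    nonempty (b ∷ V) _ = rest b ++ ⟦ V ⟧ , ⟦∷⟧ b V

    square-after : ∀ b u s c V → image b ≡ u ++ s → u ≢ [] → 1 ≤ length V →
      HasSquare (u ++ c ∷ s ++ ⟦ V ⟧)
    square-after b u s c V b≡ u≢[] 1≤V with nonempty V 1≤V
    ... | r , V≡ = subst HasSquare
      (trans (++-solve 5 (λ u c s m r → (u ⊕ c ⊕ s ⊕ m) ⊕ r ⊜ u ⊕ c ⊕ s ⊕ m ⊕ r) refl u (c ∷ []) s marker r)
        (cong (λ v → u ++ c ∷ s ++ v) (sym V≡)))
      (hasSquare-++ʳ r (closed b u s c b≡ u≢[]))

    extension : ∀ v → IsExtension ⟦ w ⟧ v → ¬ CircSquareFree v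
    -- An insertion before the first block is, in the circular word, an insertion after the last
    -- one.
    extension _ ([] , w₂ , c , refl , refl) circ′ with initLast w
    ... | [] = contradiction 2≤w λ ()
    ... | V ∷ʳ′ b = circ′ (image b ++ c ∷ ⟦ V ⟧)
      (c ∷ ⟦ V ⟧ , image b , cong (c ∷_) (trans (⟦⟧-++ V (b ∷ [])) (cong (⟦ V ⟧ ++_) (++-identityʳ (image b)))) , refl)
      (square-after b (image b) [] c V (sym (++-identityʳ (image b))) (image≢[] b)
        (s≤s⁻¹ (≤-trans 2≤w (≤-reflexive (trans (length-++ V) (+-comm (length V) 1))))))
    extension _ (w₁@(_ ∷ _) , w₂ , c , eq , refl) circ′ with split-prefix w w₁ w₂ ∷-≢[] eq
    ... | P , b , T , u , s , refl , w₁≡ , b≡ , refl , u≢[] = circ′ (u ++ c ∷ s ++ ⟦ T ++ P ⟧)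
      (⟦ P ⟧ , u ++ c ∷ s ++ ⟦ T ⟧ ,
        trans (cong (_++ c ∷ s ++ ⟦ T ⟧) w₁≡) (++-assoc ⟦ P ⟧ u _) ,
        trans (cong (λ v → u ++ c ∷ s ++ v) (⟦⟧-++ T P))
          (++-solve 5 (λ u c s t p → u ⊕ c ⊕ s ⊕ t ⊕ p ⊜ (u ⊕ c ⊕ s ⊕ t) ⊕ p) refl u (c ∷ []) s ⟦ T ⟧ ⟦ P ⟧))
      (square-after b u s c (T ++ P) b≡ u≢[] (s≤s⁻¹ (begin
        2                          ≤⟨ 2≤w ⟩
        length (P ++ b ∷ T)        ≡⟨ length-++-comm P (b ∷ T) ⟩
        suc (length (T ++ P))      ∎)))
      where open ≤-Reasoning

-- The blocks for large lengths

open import Data.Vec using (Vec; []; _∷_; lookup)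

-- Found by a computer search. Row l lists the blocks of the letter l without the marker,
-- the i-th one having length 43 + extra i with the marker.
endings : Vec (Vec String 8) 3
endings =
  ("acabcacbabcabacbcabcbacabcacbabc" ∷
   "acabcacbcabcbacbcacbabcacbcabcbacbc" ∷
   "acabcacbabcabacabcbabcabacbcabcbacbc" ∷
   "acabcacbabcabacbcabcbacbcacbabcacbcabcbacbc" ∷
   "acabcacbcabcbacbcacbacabcacbabcabacbcabcbacbc" ∷
   "acabcacbcabcbacbcacbacabcacbabcabacbcabcbacabcacbabc" ∷
   "acabcacbabcabacbcabcbacbcacbacabcacbcabacbcacbacabcacbabc" ∷
   "acabcacbabcabacabcbabcacbcabacabcbabcabacbcabcbacabcacbabc" ∷ []) ∷
  ("acabcbacbcabcbacabcacbacabcbacbc" ∷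
   "acabcbacbcabcbabcacbabcbacbcabcbabc" ∷
   "acabcbacbcabcbacabcacbcabacabcacbabc" ∷
   "acabcbacbcabcbacabcacbabcabacbabcbacabcbabc" ∷
   "acabcbacbcabcbacabcacbabcabacbabcbacbcabcbabc" ∷
   "acabcbacbcabcbacabcacbacabacbabcabacabcacbacabcbacbc" ∷
   "acabcbacbcabcbacabcacbabcabacbcabcbacabcacbcabacabcacbabc" ∷
   "acabcbacbcacbabcbacbcabacbabcbacabacbcacbacabcbacbcabcbabc" ∷ []) ∷
  ("acabacbcacbacabcbacbcabacbabcbac" ∷
   "acabcacbcabacbcacbacabcacbcabcbacbc" ∷
   "acabacbcacbabcbacabacbcacbacabcbacbc" ∷
   "acabacbcacbacabcbacbcacbabcbacbcabacbabcbac" ∷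
   "acabacbcacbabcbacbcabacbabcbacabacbcacbabcbac" ∷
   "acabacbcacbabcbacbcabacbabcabacbcabcbacbcabacbabcbac" ∷
   "acabcacbcabacbcacbacabcacbabcabacbcabcbacbcacbacabcacbabc" ∷
   "acabacbcacbabcbacbcabacbabcabacabcacbacabcbacbcabacbabcbac" ∷ []) ∷
  []

LetterBlock : Set
LetterBlock = Γ × Fin 8

commonMarker : Word
commonMarker = word "abacbabcacb"

ending : LetterBlock → Word
ending (l , i) = word (lookup (lookup endings l) i)

imageOf : LetterBlock → Word
imageOf b = commonMarker ++ ending b

∀-blocks? : {P : LetterBlock → Set} → (∀ b → Dec (P b)) → Dec (∀ b → P b)
∀-blocks? P? = map′ (λ f (l , i) → f l i) (λ f l i → f (l , i)) (Fin.all? λ l → Fin.all? λ i → P? (l , i))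

_≟ʷ_ : (u v : Word) → Dec (u ≡ v)
_≟ʷ_ = ≡-dec Fin._≟_

nonEmpty? : (u : Word) → Dec (u ≢ [])
nonEmpty? []      = no λ ≢[] → ≢[] refl
nonEmpty? (_ ∷ _) = yes λ ()

prefix? : (u v : Word) → Dec (∃ λ z → v ≡ u ++ z)
prefix? []      v       = yes (v , refl)
prefix? (c ∷ u) []      = no λ ()
prefix? (c ∷ u) (d ∷ v) with c Fin.≟ d
... | no c≢d = no λ { (z , refl) → c≢d refl }
... | yes refl = map′ (λ { (z , refl) → z , refl }) (λ { (z , refl) → z , refl }) (prefix? u v)

synchronised-check : ∀ b u s → imageOf b ≡ u ++ s → u ≢ [] → s ≢ [] →
  ¬ (∃ λ z → s ++ commonMarker ≡ commonMarker ++ z)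
synchronised-check = witness (∀-blocks? λ b → ∀-splittings? (λ u s →
  nonEmpty? u →-dec (nonEmpty? s →-dec ¬? (prefix? commonMarker (s ++ commonMarker)))) (imageOf b)) refl

prefix-free-check : ∀ b c → (∃ λ t → imageOf c ≡ imageOf b ++ t) → imageOf c ≡ imageOf b
prefix-free-check = witness (∀-blocks? λ b → ∀-blocks? λ c →
  prefix? (imageOf b) (imageOf c) →-dec (imageOf c ≟ʷ imageOf b)) refl

prefix-letter-check : ∀ b c → take 24 (imageOf b) ≡ take 24 (imageOf c) → proj₁ b ≡ proj₁ c
prefix-letter-check = witness (∀-blocks? λ b → ∀-blocks? λ c →
  (take 24 (imageOf b) ≟ʷ take 24 (imageOf c)) →-dec (proj₁ b Fin.≟ proj₁ c)) refl

last20 : Word → Word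
last20 u = drop (length u ∸ 20) u

suffix-letter-check : ∀ b c → last20 (imageOf b) ≡ last20 (imageOf c) → proj₁ b ≡ proj₁ c
suffix-letter-check = witness (∀-blocks? λ b → ∀-blocks? λ c →
  (last20 (imageOf b) ≟ʷ last20 (imageOf c)) →-dec (proj₁ b Fin.≟ proj₁ c)) refl

pair-free-check : ∀ b c → proj₁ b ≢ proj₁ c → SquareFree (imageOf b ++ imageOf c ++ commonMarker)
pair-free-check = witness (∀-blocks? λ b → ∀-blocks? λ c →
  ¬? (proj₁ b Fin.≟ proj₁ c) →-dec squareFree? (imageOf b ++ imageOf c ++ commonMarker)) refl

closed-check : ∀ b u s → imageOf b ≡ u ++ s → u ≢ [] → ∀ c → HasSquare (u ++ c ∷ s ++ commonMarker)
closed-check = witness (∀-blocks? λ b → ∀-splittings? (λ u s →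
  nonEmpty? u →-dec Fin.all? λ c → hasSquare? (u ++ c ∷ s ++ commonMarker)) (imageOf b)) refl

extra : Fin 8 → ℕ
extra = lookup (0 ∷ 3 ∷ 4 ∷ 11 ∷ 13 ∷ 20 ∷ 25 ∷ 26 ∷ [])

length-image : ∀ b → length (imageOf b) ≡ 43 + extra (proj₂ b)
length-image = witness (∀-blocks? λ b → length (imageOf b) ≟ 43 + extra (proj₂ b)) refl

blocks : MarkedSubstitution
blocks = record
  { Block         = LetterBlock
  ; letter        = proj₁
  ; marker        = commonMarker
  ; rest          = ending
  -- 24 + 20 = 43 + 1, so `pre+suf` is an equality for the shortest blocks.
  ; pre           = 24
  ; suf           = 20
  ; marker≢[]     = λ ()
  ; 0<pre         = s≤s z≤n
  ; 0<suf         = s≤s z≤n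
  ; pre+suf       = λ b → subst (λ n → 44 ≤ suc n) (sym (length-image b)) (m≤m+n 44 (extra (proj₂ b)))
  ; synchronised  = λ b u s z eq u≢[] s≢[] occ → synchronised-check b u s eq u≢[] s≢[] (z , occ)
  ; prefix-free   = λ b c t eq → ++-identityʳ-unique (imageOf b) (trans (sym (prefix-free-check b c (t , eq))) eq)
  ; prefix-letter = λ b c x s t ∣x∣ b≡ c≡ → prefix-letter-check b c
      (trans (take-prefix x s ∣x∣ b≡) (sym (take-prefix x t ∣x∣ c≡)))
  ; suffix-letter = λ b c x s t ∣x∣ b≡ c≡ → suffix-letter-check b c
      (trans (last-suffix x s ∣x∣ b≡) (sym (last-suffix x t ∣x∣ c≡)))
  ; pair-free     = pair-free-check
  ; another       = λ (l , i) → other l , i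
  ; another≢      = λ (l , i) → other≢ l
  ; closed        = λ b u s c eq u≢[] → closed-check b u s eq u≢[] c
  }
  where
  take-prefix : ∀ {u} x s → length x ≡ 24 → u ≡ x ++ s → take 24 u ≡ x
  take-prefix x s ∣x∣ refl = subst (λ n → take n (x ++ s) ≡ x) ∣x∣ (take-length-++ x)
    where
    take-length-++ : ∀ x {s : Word} → take (length x) (x ++ s) ≡ x
    take-length-++ []      = refl
    take-length-++ (c ∷ x) = cong (c ∷_) (take-length-++ x)
  last-suffix : ∀ {u} x s → length x ≡ 20 → u ≡ s ++ x → last20 u ≡ x
  last-suffix x s ∣x∣ refl = trans (cong (λ n → drop n (s ++ x)) length≡) (drop-length-++ s x)
    where
    length≡ : length (s ++ x) ∸ 20 ≡ length s
    length≡ = trans (cong₂ _∸_ (length-++ s) (sym ∣x∣)) (m+n∸n≡m (length s) (length x))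
  other : Γ → Γ
  other zero    = suc zero
  other (suc _) = zero
  other≢ : ∀ l → l ≢ other l
  other≢ zero    ()
  other≢ (suc _) ()

-- Explicit extremal words for lengths below 135

explicitWords : List Word
explicitWords = map word (
  "abac" ∷
  "abcacb" ∷
  "abcbacbc" ∷
  "abacabcacbabc" ∷
  "abcacbcabacabcb" ∷
  "abacbcacbabcacbc" ∷
  "abacbabcabacabcbac" ∷
  "abcbacbcabcbabcabacb" ∷
  "abacbabcacbacabcbacbc" ∷
  "abacbabcabacbcabcbacbc" ∷
  "abcabacabcbabcabacbcacb" ∷
  "abacabcbabcacbacabcbacbc" ∷
  "abacabcacbcabacbcacbacabacbc" ∷
  "abacabcacbabcabacbcabcbabcacbc" ∷
  "abacbcabcbacabcacbcabacabcacbabc" ∷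
  "abcacbabcbacbcabcbacabcacbabcabac" ∷
  "abcabacbcabcbacbcabacbabcbacbcabcb" ∷
  "abacbabcbacabacbabcacbacabcbabcacbc" ∷
  "abcacbabcabacbabcacbacabcbacbcabcbac" ∷
  "abcabacbcabcbacabcacbcabcbacabacbcabcb" ∷
  "abcacbcabcbacbcabacbabcbacabacbabcacbac" ∷
  "abcbacbcacbabcabacbcabcbacabcacbacabacbc" ∷
  "abacabcbabcacbcabcbacabcacbcabacabcacbabc" ∷
  "abacabcacbacabacbabcabacbcabcbacbcabacbabc" ∷
  "abcacbcabcbacbcabacbabcbacabacbabcacbacabcb" ∷
  "abacbabcabacabcbacabacbcabacabcacbacabcbacbc" ∷
  "abacabcbabcacbacabcacbcabcbacbcacbacabcacbabc" ∷
  "abcbacabacbcabcbacabcacbacabcbacbcabcbacabcacb" ∷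
  "abcabacabcbacbcacbacabcbacbcabcbacabcacbacabacb" ∷
  "abcbacabacbabcabacbcabcbacabcacbabcabacbabcbacbc" ∷
  "abcabacbcabcbacabcacbcabacabcbabcacbcabcbacabcacb" ∷
  "abacbcacbacabcbacbcabcbacabcacbacabcbacbcacbabcbac" ∷
  "abcbabcabacbcabcbacabcacbacabacbabcabacabcbacabacbc" ∷
  "abacbcacbacabcacbcabacbcacbabcacbcabcbacbcacbabcacbc" ∷
  "abcabacbabcbacabcacbabcabacbcabcbabcabacbcacbacabcacb" ∷
  "abacabcbabcabacbcabcbabcacbcabcbacabcacbcabacabcacbabc" ∷
  "abcbacabcacbcabacabcacbabcabacbabcbacabcbabcacbabcbacbc" ∷
  "abcbacabacbabcabacbcabcbacbcabacbabcacbacabcacbabcabacbc" ∷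
  "abcabacabcacbacabacbcabacabcacbacabcbacbcacbabcbacbcabacb" ∷
  "abcbacbcacbabcbacabacbabcacbacabcacbcabcbacbcabacbabcacbac" ∷
  "abacabcacbacabacbabcabacbcabcbacabcacbabcabacbcabcbacabacbc" ∷
  "abcabacabcacbacabcbacbcabcbacabcacbacabacbcabacabcacbacabacb" ∷
  "abcbabcabacbabcbacbcabcbabcabacbabcacbacabcbacbcabacbabcacbac" ∷
  "abcbacabacbabcabacbcabcbacbcabacbabcacbacabcbacbcabcbacabcacbc" ∷
  "abcbabcacbcabacabcacbabcabacabcbabcabacbcabcbacbcabacbabcabacbc" ∷
  "abacbabcbacbcabacbabcacbacabacbcacbabcbacbcabacbabcabacbcabcbabc" ∷
  "abcbabcabacabcbacbcacbabcbacbcabacbabcbacabacbabcacbacabacbcacbac" ∷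
  "abcbacabacbabcacbacabcacbabcabacabcbabcacbcabcbacabcacbcabacabcacb" ∷
  "abacbcabcbacbcabacbabcbacabacbabcacbacabcacbabcabacbcabcbacabcacbac" ∷
  "abacabcacbacabacbabcacbacabcbacbcabcbabcabacbabcbacbcabcbacabcacbabc" ∷
  "abcbabcabacbabcacbacabcacbcabcbacbcabacbabcacbacabcacbabcabacabcacbac" ∷
  "abcbacabacbcabcbacbcabacbabcbacabacbabcacbacabcacbabcabacbcabcbabcacbc" ∷
  "abacabcbacabacbabcabacbcabcbacbcabacbabcabacbcabcbacabcacbcabcbacabacbc" ∷
  "abacabcacbcabacbabcacbacabcbacbcabacbabcbacabacbabcacbacabcbacbcabacbabc" ∷
  "abcbacabacbabcacbacabcacbabcabacbabcbacbcabcbacabcacbabcabacbcabcbabcacbc" ∷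
  "abacbabcacbcabacbcacbabcacbcabcbacbcabacbabcacbacabcbacbcacbacabcbabcacbac" ∷
  "abacbabcabacbcabcbabcacbcabcbacabcacbcabacabcbabcacbcabcbacabcacbacabcbacbc" ∷
  "abcbacabcacbacabacbcabacabcacbacabcbacbcabcbabcacbabcbacabcbabcabacbabcbacbc" ∷
  "abacbabcbacbcacbacabcbacbcacbabcbacbcabacbabcacbacabcacbabcabacbabcbacabcbabc" ∷
  "abacbabcabacabcacbabcabacbabcacbacabcacbcabacbcacbabcacbcabcbacbcabacbabcacbac" ∷
  "abcbacabacbcabacabcbacabacbabcabacbcabcbabcacbcabcbacabcacbabcabacbcabcbabcacbc" ∷
  "abacbcabcbacabacbabcacbacabcbacbcacbabcbacbcabacbabcabacbcabcbabcacbcabacabcbabc" ∷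
  "abacbcacbabcbacabacbabcacbacabcacbcabcbacbcabacbabcabacbcabcbabcacbcabacabcacbabc" ∷
  "abacabcbabcabacbcabcbacbcacbacabcacbcabacbcacbacabcacbabcabacbabcacbacabacbcacbabc" ∷
  "abcbabcacbcabcbacbcacbacabcacbabcabacbcabcbacabcacbacabcbacbcacbabcbacabacbabcacbac" ∷
  "abcbabcacbabcbacbcabacbabcbacabacbabcacbacabcbacbcacbabcbacbcabacbabcbacabacbabcacbc" ∷
  "abcacbabcabacabcbabcacbcabcbacabcacbabcabacbabcacbacabacbcacbabcbacbcabacbabcacbcabac" ∷
  "abacbcacbacabcacbcabacbcacbabcacbcabcbacbcabacbabcacbacabacbcacbacabcbacbcabacbabcacbc" ∷
  "abcbabcacbacabcacbabcabacbabcbacabcbabcabacbabcacbacabcacbcabcbacbcacbacabcacbabcabacbc" ∷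
  "abcacbcabcbacbcacbabcacbcabacbcacbacabcacbcabcbacbcabacbabcacbacabcbacbcacbabcbacbcabacb" ∷
  "abacabcacbabcabacabcbabcacbcabacabcacbabcabacbcabcbacbcabacbabcacbacabcbacbcabcbacabcacbc" ∷
  "abacabcbacabacbabcabacabcacbacabacbcabacabcacbacabcbacbcabacbabcabacbcabcbacabcacbacabacbc" ∷
  "abcbabcabacabcbacabacbabcabacabcacbacabacbabcabacbcabcbacabcacbacabcbacbcabcbabcabacbabcbac" ∷
  "abacbabcabacabcacbabcabacbabcacbacabacbcacbabcbacabacbcacbacabcbacbcacbabcbacbcabacbabcacbac" ∷
  "abcacbacabcacbabcabacbabcacbacabcacbcabcbacbcabacbabcbacabacbabcacbacabacbcacbacabcbacbcabacb" ∷
  "abacbabcabacbcabcbabcacbcabcbacabcacbcabacabcbabcacbcabacabcacbabcabacbcabcbacabcacbacabcbacbc" ∷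
  "abacabcbacbcacbacabcbacbcabcbabcacbabcbacabcbabcabacbabcacbacabcbacbcabacbabcabacabcacbacabacbc" ∷
  "abacabcbabcacbcabcbacabcacbabcabacabcbabcabacbcabcbacabcacbabcabacbcabcbacbcacbacabcacbcabcbacbc" ∷
  "abcabacabcbacabacbcabacabcacbacabacbabcabacbcabcbacabcacbcabacabcacbabcabacbabcacbacabcbacbcabacb" ∷
  "abcbacbcabcbabcabacbcabcbacabcacbacabcbacbcacbabcbacabacbcacbacabcbacbcabcbacabcacbacabcbacbcabacb" ∷
  "abcbabcabacbabcacbacabcacbabcabacbabcacbacabacbcacbacabcbacbcabacbabcacbacabcacbabcabacabcacbabcbac" ∷
  "abcabacabcbabcacbcabcbacabcacbacabcbacbcacbabcbacbcabacbabcabacbcabcbacbcacbabcacbcabacbcacbacabcacb" ∷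
  "abacabcbabcacbacabcbacbcacbabcbacabacbcacbacabcbacbcacbabcbacbcabacbabcacbacabacbcacbabcbacbcabacbabc" ∷
  "abcbabcabacbcacbacabcbacbcacbabcbacbcabacbabcacbacabacbcacbacabcbacbcabacbabcabacbcabcbacabcacbabcabac" ∷
  "abcbabcacbabcbacbcabacbabcacbacabcacbcabcbacbcabacbabcacbacabcacbabcabacbcabcbacbcabacbabcacbacabcbacbc" ∷
  "abcacbacabcacbcabacabcbabcabacbcabcbacbcabacbabcbacabacbabcacbacabcacbcabcbacbcabacbabcacbacabcbabcabacb" ∷
  "abacbabcabacabcacbacabcbacbcabcbabcabacbabcacbacabcbacbcabcbacabcacbabcabacbcabcbacbcacbacabcacbcabcbacbc" ∷
  "abcabacabcbabcacbcabacabcbabcabacbcabcbabcacbcabcbacabcacbcabacabcacbabcabacbabcacbacabacbcacbabcbacabcacb" ∷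
  "abacabcbabcabacbabcbacbcabcbacabcacbcabacabcbabcabacbcabcbacabcacbacabacbabcabacabcacbacabcbacbcacbabcbacbc" ∷
  "abcabacbabcbacabacbcacbabcbacbcabacbabcbacabacbcacbacabcbacbcacbabcbacbcabacbabcabacabcbacabacbabcabacbcabcb" ∷
  "abcabacbabcbacbcabacbabcabacbcabcbacbcabacbabcbacabacbcacbabcbacabacbabcacbacabcbacbcabacbabcabacabcacbacabcb" ∷
  "abacbcacbacabcbacbcacbabcbacbcabacbabcacbacabcbacbcacbabcbacabacbabcacbacabcacbabcabacabcbabcacbcabacabcacbabc" ∷
  "abacbabcabacbcabcbacabcacbabcabacabcbabcacbcabcbacabcacbacabcbacbcacbabcbacbcabacbabcabacabcacbacabcbacbcabcbac" ∷
  "abcbacbcacbabcabacabcbabcabacbcabcbacbcacbacabcacbcabcbacbcacbabcacbcabcbacbcabacbabcabacbcabcbacbcabacbabcacbac" ∷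
  "abacabcbabcacbcabacabcacbabcabacabcbabcacbcabcbacabcacbabcabacabcbabcabacbcabcbacbcabacbabcbacabacbcacbacabcbacbc" ∷
  "abacabcacbabcabacbabcacbacabcacbcabcbacbcabacbabcbacabacbcacbabcbacabacbabcacbacabacbcacbabcbacabacbcacbacabcbacbc" ∷
  "abcbacabacbabcacbacabacbcacbacabcbacbcacbabcbacabacbabcacbacabcacbcabcbacbcacbabcacbcabcbacbcabacbabcacbacabacbcacb" ∷
  "abcbabcabacbabcacbacabacbcacbabcbacabacbcacbacabcbacbcacbabcbacbcabacbabcacbacabcacbcabacbcacbacabcacbabcabacbabcbac" ∷
  "abacbabcabacbcabcbacabcacbcabacabcbabcabacbcabcbabcacbcabacabcacbabcabacbcabcbabcacbcabcbacabcacbacabacbcabacabcacbac" ∷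
  "abacbabcbacbcabcbabcabacbcabcbacabcacbacabacbabcabacabcbacabacbabcabacbcabcbacbcacbabcacbcabcbacbcacbacabcacbcabcbacbc" ∷
  "abcacbcabacabcacbacabacbabcabacbcabcbabcacbcabacabcbabcabacbcabcbacabcacbabcabacbabcbacabcbabcabacbabcbacbcabcbabcabacb" ∷
  "abcbabcacbcabacabcbacbcacbabcbacbcabacbabcacbacabcacbabcabacabcbabcacbcabacabcbabcabacbcabcbacbcacbacabcacbcabcbacbcabac" ∷
  "abacabcacbacabcbacbcacbabcbacbcabacbabcbacabacbcacbacabcbacbcabacbabcabacabcacbacabacbcabacabcbacabacbabcabacabcbacabacbc" ∷
  "abacbcacbacabcacbabcabacbabcbacbcabcbacabcacbcabacabcacbabcabacabcbabcacbcabcbacabcacbacabacbabcabacbcabcbacbcacbacabcacbc" ∷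
  "abcabacbcacbabcbacabacbabcacbacabcbacbcabacbabcacbacabcacbcabcbacbcabacbabcabacbcabcbacabcacbabcabacbcabcbabcacbcabacabcacb" ∷
  "abacabcbacabacbabcabacabcbacabacbcabacabcacbacabcbacbcabcbabcacbabcbacbcabcbabcabacbabcacbacabacbcacbacabcbacbcabacbabcbacbc" ∷
  "abcbabcabacbcabcbacabcacbcabacabcacbabcabacbcabcbabcacbcabcbacabcacbcabacabcacbabcabacabcbabcabacbcabcbacbcacbacabcacbabcabac" ∷
  "abcabacabcbabcabacbcabcbacabcacbcabacabcbabcacbcabacabcacbabcabacbabcacbacabcbacbcabacbabcabacabcbacabacbabcabacbcabcbacabcacb" ∷
  "abcabacbabcbacbcabcbacabcacbacabacbcabacabcbacabacbabcabacbcabcbacbcacbacabcacbabcabacbabcacbacabcbacbcabcbabcabacbabcacbacabcb" ∷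
  "abcabacabcbacbcabacbabcacbacabcbacbcabacbabcbacabacbabcacbacabcacbcabacbcacbacabcacbabcabacabcbabcabacbcabcbacabcacbcabcbacabacb" ∷
  "abacabcbacbcabacbabcbacabacbcacbacabcbacbcabcbabcacbabcbacabcbabcabacbabcbacabcbabcacbabcbacbcabcbacabcacbacabcbacbcabcbacabcacbc" ∷
  "abcbacabcacbabcabacabcbabcabacbcabcbabcacbcabacabcacbabcabacabcbabcacbcabcbacabcacbcabacabcacbabcabacbabcbacbcabcbacabcacbabcabacb" ∷
  "abacabcbacbcabacbabcbacabacbabcacbacabacbcacbabcbacbcabacbabcbacabacbcacbabcbacabacbabcacbacabcbacbcacbabcbacbcabacbabcacbacabcacbc" ∷
  "abcacbcabcbabcacbcabacabcbabcacbcabcbacabcacbacabacbcabacabcacbacabcbacbcabacbabcabacbcabcbabcacbcabcbacabcacbcabacabcbabcacbcabcbac" ∷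
  "abacbcabcbabcacbabcbacabcbabcabacbabcbacabcbabcacbabcbacbcabcbacabcacbacabacbcabacabcacbacabcbacbcabcbacabcacbabcabacbcabcbacbcacbabc" ∷
  "abcacbacabcbacbcabacbabcbacabacbcacbabcbacbcabacbabcacbacabacbcacbabcbacabacbcacbacabcbacbcacbabcbacabacbabcacbacabcacbabcabacbcabcbac" ∷
  [])

explicitWords-extremal : All ExtremalSquareFree explicitWords
explicitWords-extremal = witness (All.all? extremal? explicitWords) refl

explicitWords-lengths : map length explicitWords ≡ smallLengths ++ applyUpTo (38 +_) 97
explicitWords-lengths = refl

-- Existence for all remaining lengths

-- Neither 5 nor 67 is a sum of three of these amounts, so the interval from 6 to 66 cannot be
-- enlarged; this is the origin of the margins 6 and 12 = 3 · 26 - 66. It has more than 26 elements,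
-- so adding 0 or 26 for each further block leaves no gap.
extra-sums : ∀ (r : Fin 61) → ∃ λ i → ∃₂ λ j k → extra i + (extra j + extra k) ≡ 6 + toℕ r
extra-sums = witness (Fin.all? λ r → Fin.any? λ i → Fin.any? λ j → Fin.any? λ k →
  extra i + (extra j + extra k) ≟ 6 + toℕ r) refl

ExtremalOfLength CircularOfLength : ℕ → Set
ExtremalOfLength n = ∃ λ (w : Word) → (length w ≡ n) × ExtremalSquareFree w
CircularOfLength n = ∃ λ (w : Word) → (length w ≡ n) × CircSquareFree w

extremal⇒circular : ∀ {n} → ExtremalOfLength n → CircularOfLength n
extremal⇒circular (w , ∣w∣ , circ , _) = w , ∣w∣ , circ

excess≤ : ∀ a b {n} → a + 6 ≤ n → n + 12 ≤ a + b → n ∸ (a + 6) + 18 ≤ b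
excess≤ a b {n} lower upper = +-cancelˡ-≤ a (n ∸ (a + 6) + 18) b (begin
  a + (n ∸ (a + 6) + 18)      ≡⟨ +-*-solve 2 (λ a b → a :+ (b :+ con 18) := a :+ con 6 :+ b :+ con 12) refl a (n ∸ (a + 6)) ⟩
  a + 6 + (n ∸ (a + 6)) + 12  ≡⟨ cong (_+ 12) (m+[n∸m]≡n lower) ⟩
  n + 12                      ≤⟨ upper ⟩
  a + b                       ∎)
  where open ≤-Reasoning

three-lengths : ∀ i j k → 43 + i + (43 + j + (43 + k + 0)) ≡ 129 + (i + (j + k))
three-lengths = +-*-solve 3 (λ i j k →
  con 43 :+ i :+ (con 43 :+ j :+ (con 43 :+ k :+ con 0)) := con 129 :+ (i :+ (j :+ k))) refl

longest-first : ∀ n s → 69 + (43 * n + (6 + s)) ≡ 43 * suc n + (6 + (26 + s))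
longest-first = +-*-solve 2 (λ n s →
  con 69 :+ (con 43 :* n :+ (con 6 :+ s)) := con 43 :* (con 1 :+ n) :+ (con 6 :+ (con 26 :+ s))) refl

-- With `σ` abstract, block lengths are known only through `length-block`, and the arithmetic never
-- unfolds the concrete words.
module Lengths (σ : MarkedSubstitution)
  (block : Γ → Fin 8 → MarkedSubstitution.Block σ)
  (letter-block : ∀ l i → MarkedSubstitution.letter σ (block l i) ≡ l)
  (length-block : ∀ l i → length (MarkedSubstitution.image σ (block l i)) ≡ 43 + extra i) where

  open MarkedSubstitution σ
  open Images σ

  length-∷ : ∀ l i W → length ⟦ block l i ∷ W ⟧ ≡ (43 + extra i) + length ⟦ W ⟧
  length-∷ l i W = trans (length-++ (image (block l i))) (cong (_+ length ⟦ W ⟧) (length-block l i))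

  -- Three blocks realise every total length from 3 · 43 + 6 to 3 · 69 − 12; each further
  -- block is given length 43 or 69.
  choose-blocks : ∀ w r → 3 ≤ length w → r + 18 ≤ 26 * length w →
    ∃ λ W → map letter W ≡ w × length ⟦ W ⟧ ≡ 43 * length w + (6 + r)
  choose-blocks (_ ∷ []) _ (s≤s ()) _
  choose-blocks (_ ∷ _ ∷ []) _ (s≤s (s≤s ())) _
  choose-blocks (c ∷ d ∷ e ∷ []) r _ r≤ = three (extra-sums (fromℕ< (s≤s r≤60)))
    where
    r≤60 : r ≤ 60
    r≤60 = +-cancelʳ-≤ 18 r 60 r≤
    three : (∃ λ i → ∃₂ λ j k → extra i + (extra j + extra k) ≡ 6 + toℕ (fromℕ< (s≤s r≤60))) →
      ∃ λ W → map letter W ≡ c ∷ d ∷ e ∷ [] × length ⟦ W ⟧ ≡ 129 + (6 + r)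
    three (i , j , k , sum) = block c i ∷ block d j ∷ block e k ∷ []
      , cong₂ _∷_ (letter-block c i) (cong₂ _∷_ (letter-block d j) (cong (_∷ []) (letter-block e k)))
      , (begin
      length ⟦ block c i ∷ block d j ∷ block e k ∷ [] ⟧
        ≡⟨ length-∷ c i (block d j ∷ block e k ∷ []) ⟩
      43 + extra i + length ⟦ block d j ∷ block e k ∷ [] ⟧
        ≡⟨ cong (43 + extra i +_) (trans (length-∷ d j (block e k ∷ [])) (cong (43 + extra j +_) (length-∷ e k []))) ⟩
      43 + extra i + (43 + extra j + (43 + extra k + 0))
        ≡⟨ three-lengths (extra i) (extra j) (extra k) ⟩
      129 + (extra i + (extra j + extra k))
        ≡⟨ cong (129 +_) (trans sum (cong (6 +_) (Fin.toℕ-fromℕ< (s≤s r≤60)))) ⟩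
      129 + (6 + r) ∎)
      where open ≡-Reasoning
  choose-blocks (c ∷ w@(_ ∷ _ ∷ _ ∷ _)) r _ r≤ =
    [ (λ fits → shortest (choose-blocks w r (s≤s (s≤s (s≤s z≤n))) fits))
    , (λ exceeds → longest (26≤r exceeds) (choose-blocks w (r ∸ 26) (s≤s (s≤s (s≤s z≤n))) (fits (26≤r exceeds))))
    ]′ (≤-<-connex (r + 18) (26 * length w))
    where
    shortest : (∃ λ W → map letter W ≡ w × length ⟦ W ⟧ ≡ 43 * length w + (6 + r)) →
      ∃ λ W → map letter W ≡ c ∷ w × length ⟦ W ⟧ ≡ 43 * suc (length w) + (6 + r)
    shortest (W , letters , ∣W∣) = block c zero ∷ W , cong₂ _∷_ (letter-block c zero) letters , (begin
      length ⟦ block c zero ∷ W ⟧     ≡⟨ length-∷ c zero W ⟩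
      43 + length ⟦ W ⟧               ≡⟨ cong (43 +_) ∣W∣ ⟩
      43 + (43 * length w + (6 + r))  ≡⟨ +-assoc 43 (43 * length w) (6 + r) ⟨
      43 + 43 * length w + (6 + r)    ≡⟨ cong (_+ (6 + r)) (*-suc 43 (length w)) ⟨
      43 * suc (length w) + (6 + r)   ∎)
      where open ≡-Reasoning
    26≤r : 26 * length w < r + 18 → 26 ≤ r
    26≤r exceeds = +-cancelʳ-≤ 18 26 r (≤-trans (m≤m+n 44 34)
      (≤-trans (*-monoʳ-≤ 26 {3} {length w} (s≤s (s≤s (s≤s z≤n)))) (<⇒≤ exceeds)))
    fits : 26 ≤ r → r ∸ 26 + 18 ≤ 26 * length w
    fits 26≤r = +-cancelˡ-≤ 26 (r ∸ 26 + 18) (26 * length w) (begin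
      26 + (r ∸ 26 + 18)      ≡⟨ +-assoc 26 (r ∸ 26) 18 ⟨
      26 + (r ∸ 26) + 18      ≡⟨ cong (_+ 18) (m+[n∸m]≡n 26≤r) ⟩
      r + 18                  ≤⟨ r≤ ⟩
      26 * suc (length w)     ≡⟨ *-suc 26 (length w) ⟩
      26 + 26 * length w      ∎)
      where open ≤-Reasoning
    longest : 26 ≤ r → (∃ λ W → map letter W ≡ w × length ⟦ W ⟧ ≡ 43 * length w + (6 + (r ∸ 26))) →
      ∃ λ W → map letter W ≡ c ∷ w × length ⟦ W ⟧ ≡ 43 * suc (length w) + (6 + r)
    longest 26≤r (W , letters , ∣W∣) = block c i ∷ W , cong₂ _∷_ (letter-block c i) letters , (begin
      length ⟦ block c i ∷ W ⟧                    ≡⟨ length-∷ c i W ⟩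
      69 + length ⟦ W ⟧                           ≡⟨ cong (69 +_) ∣W∣ ⟩
      69 + (43 * length w + (6 + (r ∸ 26)))       ≡⟨ longest-first (length w) (r ∸ 26) ⟩
      43 * suc (length w) + (6 + (26 + (r ∸ 26))) ≡⟨ cong (λ r → 43 * suc (length w) + (6 + r)) (m+[n∸m]≡n 26≤r) ⟩
      43 * suc (length w) + (6 + r)               ∎)
      where
      open ≡-Reasoning
      i : Fin 8
      i = opposite zero

  substitute : ∀ m {n} → CircularOfLength m → 3 ≤ m → 43 * m + 6 ≤ n → n + 12 ≤ 69 * m → ExtremalOfLength n
  substitute m {n} (w , refl , circ) 3≤m lower upper = assemble
    (choose-blocks w (n ∸ (43 * m + 6)) 3≤m
      (excess≤ (43 * m) (26 * m) lower (≤-trans upper (≤-reflexive (*-distribʳ-+ m 43 26)))))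
    where
    assemble : (∃ λ W → map letter W ≡ w × length ⟦ W ⟧ ≡ 43 * m + (6 + (n ∸ (43 * m + 6)))) → ExtremalOfLength n
    assemble (W , refl , ∣W∣) = ⟦ W ⟧
      , trans ∣W∣ (trans (sym (+-assoc (43 * m) 6 _)) (m+[n∸m]≡n lower))
      , extremal-image W (≤-trans (n≤1+n 2) (≤-trans 3≤m (≤-reflexive (length-map letter W)))) circ

open Lengths blocks _,_ (λ _ _ → refl) (λ l i → length-image (l , i)) using (substitute)

explicit : ∀ {n} → n ∈ smallLengths ++ applyUpTo (38 +_) 97 → ExtremalOfLength n
explicit {n} n∈ with ∈-map⁻ length {xs = explicitWords} (subst (n ∈_) (sym explicitWords-lengths) n∈)
... | w , w∈ , refl = w , refl , All.lookup explicitWords-extremal w∈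

-- Lengths 3 and 12 are not among the listed ones, but a substitution accepts any circular
-- square-free word as input.
circular-3 : CircularOfLength 3
circular-3 = word "abc" , refl , witness (circSquareFree? (word "abc")) refl

circular-12 : CircularOfLength 12
circular-12 = word "abacabcbacbc" , refl , witness (circSquareFree? (word "abacabcbacbc")) refl

-- The quotient is the largest `m` with `43 m + 6 ≤ n`. A remainder of at most 43, together with 18
-- for the two margins, is far below `26 m` once `m ≥ 38`, the bound that the induction hypothesis
-- requires.
divide-by-43 : ∀ n → 1920 < n → ∃ λ m → m < n × 38 ≤ m × 43 * m + 6 ≤ n × n + 12 ≤ 69 * m
divide-by-43 n 1920<n = (n ∸ 6) / 43 , m<n , 38≤m , lower , upper
  where
  6+[n∸6]≡n : n ∸ 6 + 6 ≡ n
  6+[n∸6]≡n = m∸n+n≡m (≤-trans (≤ᵇ⇒≤ 6 1921 _) 1920<n)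
  38≤m : 38 ≤ (n ∸ 6) / 43
  38≤m = /-monoˡ-≤ {1634} {n ∸ 6} 43 (∸-monoˡ-≤ 6 (≤-trans (≤ᵇ⇒≤ 1640 1921 _) 1920<n))
  m<n : (n ∸ 6) / 43 < n
  m<n = ≤-<-trans (m/n≤m (n ∸ 6) 43) (≤-trans (m<m+n (n ∸ 6) {6} z<s) (≤-reflexive 6+[n∸6]≡n))
  lower : 43 * ((n ∸ 6) / 43) + 6 ≤ n
  lower = ≤-trans
    (+-monoˡ-≤ 6 (≤-trans (≤-reflexive (*-comm 43 ((n ∸ 6) / 43))) (m/n*n≤m (n ∸ 6) 43)))
    (≤-reflexive 6+[n∸6]≡n)
  upper : n + 12 ≤ 69 * ((n ∸ 6) / 43)
  upper = begin
    n + 12                                    ≡⟨ cong (_+ 12) 6+[n∸6]≡n ⟨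
    n ∸ 6 + 6 + 12                            ≡⟨ +-assoc (n ∸ 6) 6 12 ⟩
    n ∸ 6 + 18                                ≡⟨ cong (_+ 18) (m≡m%n+[m/n]*n (n ∸ 6) 43) ⟩
    (n ∸ 6) % 43 + (n ∸ 6) / 43 * 43 + 18     ≤⟨ remainder ((n ∸ 6) % 43) ((n ∸ 6) / 43) (<⇒≤ (m%n<n (n ∸ 6) 43)) 38≤m ⟩
    69 * ((n ∸ 6) / 43)                       ∎
    where
    open ≤-Reasoning
    remainder : ∀ r m → r ≤ 43 → 38 ≤ m → r + m * 43 + 18 ≤ 69 * m
    remainder r m r≤43 38≤m = begin
      r + m * 43 + 18       ≤⟨ +-monoˡ-≤ 18 (+-monoˡ-≤ (m * 43) r≤43) ⟩
      43 + m * 43 + 18      ≡⟨ +-*-solve 1 (λ m → con 43 :+ m :* con 43 :+ con 18 := con 61 :+ con 43 :* m) refl m ⟩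
      61 + 43 * m           ≤⟨ +-monoˡ-≤ (43 * m) (≤-trans (m≤m+n 61 927) (*-monoʳ-≤ 26 38≤m)) ⟩
      26 * m + 43 * m       ≡⟨ *-distribʳ-+ m 26 43 ⟨
      69 * m                ∎

-- The ranges of lengths obtained from the circular words of length
-- 3, 4, 6, 8, 12, 18, 28 overlap; from there on, divide by 43.
large : ∀ n → 135 ≤ n → (∀ {m} → m < n → 38 ≤ m → ExtremalOfLength m) → ExtremalOfLength n
large n 135≤n shorter = go
  where
  from-word : ∀ m {k} → CircularOfLength m → T (3 ≤ᵇ m) → T (43 * m + 6 ≤ᵇ k) →
    k ≤ n → n + 12 ≤ 69 * m → ExtremalOfLength n
  from-word m {k} circ 3≤m lower k≤n =
    substitute m circ (≤ᵇ⇒≤ 3 m 3≤m) (≤-trans (≤ᵇ⇒≤ (43 * m + 6) k lower) k≤n)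

  listed : ∀ m → m ∈ smallLengths → CircularOfLength m
  listed m m∈ = extremal⇒circular (explicit (∈-++⁺ˡ m∈))

  go : ExtremalOfLength n
  go with n ≤? 195
  ... | yes ≤195 = from-word 3 circular-3 _ _ 135≤n (+-monoˡ-≤ 12 ≤195)
  ... | no  >195 with n ≤? 264
  ... | yes ≤264 = from-word 4 (listed 4 (from-yes (4 ∈? smallLengths))) _ _ (≰⇒> >195) (+-monoˡ-≤ 12 ≤264)
  ... | no  >264 with n ≤? 402
  -- The range of 6 begins at 264, exactly where that of 4 ends. Nothing of length 5 could bridge a
  -- gap: a circular word of five letters over a, b, c without equal neighbours has letter counts 2,
  -- 2, 1, and opposite its single letter stands a square such as `abab`.
  ... | yes ≤402 = from-word 6 (listed 6 (from-yes (6 ∈? smallLengths))) _ _ (≰⇒> >264) (+-monoˡ-≤ 12 ≤402)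
  ... | no  >402 with n ≤? 540
  ... | yes ≤540 = from-word 8 (listed 8 (from-yes (8 ∈? smallLengths))) _ _ (≰⇒> >402) (+-monoˡ-≤ 12 ≤540)
  ... | no  >540 with n ≤? 816
  ... | yes ≤816 = from-word 12 circular-12 _ _ (≰⇒> >540) (+-monoˡ-≤ 12 ≤816)
  ... | no  >816 with n ≤? 1230
  ... | yes ≤1230 = from-word 18 (listed 18 (from-yes (18 ∈? smallLengths))) _ _ (≰⇒> >816) (+-monoˡ-≤ 12 ≤1230)
  ... | no  >1230 with n ≤? 1920
  ... | yes ≤1920 = from-word 28 (listed 28 (from-yes (28 ∈? smallLengths))) _ _ (≰⇒> >1230) (+-monoˡ-≤ 12 ≤1920)
  ... | no  >1920 = by-division (divide-by-43 n (≰⇒> >1920))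
    where
    by-division : (∃ λ m → m < n × 38 ≤ m × 43 * m + 6 ≤ n × n + 12 ≤ 69 * m) → ExtremalOfLength n
    by-division (m , m<n , 38≤m , lower , upper) =
      substitute m (extremal⇒circular (shorter m<n 38≤m)) (≤-trans (m≤m+n 3 35) 38≤m) lower upper

extremal-≥38 : ∀ n → 38 ≤ n → ExtremalOfLength n
extremal-≥38 = <-rec _ λ n shorter 38≤n → [ (λ 135≤n → large n 135≤n shorter) , middle n 38≤n ]′ (≤-<-connex 135 n)
  where
  middle : ∀ n → 38 ≤ n → n < 135 → ExtremalOfLength n
  middle n 38≤n n<135 = explicit (∈-++⁺ʳ smallLengths (subst (_∈ applyUpTo (38 +_) 97) (m+[n∸m]≡n 38≤n)
    (∈-applyUpTo⁺ (38 +_) (+-cancelˡ-< 38 (n ∸ 38) 97 (≤-trans (≤-reflexive (cong suc (m+[n∸m]≡n 38≤n))) n<135)))))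

theorem3 : ∀ (n : ℕ) →
    (∃ λ (w : Word) → (length w ≡ n) × ExtremalSquareFree w) ⇔ GoodLength n
theorem3 n = mk⇔ necessary sufficient
  where
  necessary : ExtremalOfLength n → GoodLength n
  necessary (w , refl , ext) with length w ≤? 37
  ... | yes ≤37 = inj₁ (short-extremal w ext ≤37)
  ... | no  >37 = inj₂ (≰⇒> >37)
  sufficient : GoodLength n → ExtremalOfLength n
  sufficient (inj₁ n∈)   = explicit (∈-++⁺ˡ n∈)
  sufficient (inj₂ 38≤n) = extremal-≥38 n 38≤n
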